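{- Let $\alpha\in(0,1)$ be a fixed constant. For every finite directed graph $G=\langle V,E\rangle$ with $n=|V|$ nodes and $m=|E|$ edges in which every node has out-degree at least $1$, every source node $s\in V$, and every real $r_{\max}$ with $0<r_{\max}<\frac{1}{2m}$, put $\lambda=m\cdot r_{\max}$. Then the algorithm First-In-First-Out Forward Push (FIFO-FwdPush), run on input $(G,\alpha,s,r_{\max})$, terminates, and its overall running time is bounded by $O\left(m\cdot\log\frac{1}{\lambda}\right)$, where the implied constant depends only on $\alpha$.
   Context: For $v\in V$, $N_{out}(v)=\{u : (v,u)\in E\}$ and $d_v=|N_{out}(v)|$, so $m=\sum_{v\in V}d_v$. FIFO-FwdPush on input $(G,\alpha,s,r_{\max})$ maintains for each node $v$ two reals, a reserve $\hat\pi(s,v)$ and a residue $r(s,v)$, and a first-in-first-out queue $Q$. Initially $\hat\pi(s,v)=0$ and $r(s,v)=0$ for all $v\in V$, except $r(s,s)=1$, and $Q$ contains only $s$. While $Q\neq\emptyset$: pop (and remove) the front node $v$ of $Q$; set $\hat\pi(s,v)\leftarrow\hat\pi(s,v)+\alpha\cdot r(s,v)$; for each $u\in N_{out}(v)$, set $r(s,u)\leftarrow r(s,u)+\frac{(1-\alpha)\cdot r(s,v)}{d_v}$ and, if $r(s,u)>d_u\cdot r_{\max}$ and $u\notin Q$, append $u$ at the end of $Q$; after the loop over $N_{out}(v)$, set $r(s,v)\leftarrow 0$. When $Q$ is empty the algorithm stops and returns all reserves and residues. Cost model: elementary real arithmetic, comparisons, queue operations and testing membership in $Q$ take $O(1)$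 time each, so processing one popped node $v$ (a push operation on $v$) costs $O(d_v)$, and initialization costs $O(n)$. -}

module Defs where

open import Level using (0ℓ)
open import Algebra.Bundles using (CommutativeRing)
import Algebra.Properties.Semiring.Exp as SemiringExp
import Algebra.Properties.Semiring.Mult as SemiringMult
open import Data.Empty using (⊥-elim)
open import Data.Fin.Base using (Fin)
import Data.Fin.Properties as Fin
open import Data.List.Base
  using (List; []; _∷_; [_]; _++_; length; map; sum; allFin; foldl)
import Data.List.Membership.DecPropositional as DecMembership
open import Data.List.Relation.Unary.Unique.Propositional using (Unique)
open import Data.Nat.Base as ℕ using (ℕ; zero; suc; z≤n; s≤s)
import Data.Nat.Properties as ℕ
open import Data.Product.Base using (_×_; _,_; ∃; ∃-syntax; proj₁; proj₂)
open import Data.Sum.Base using (inj₁; inj₂)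
open import Data.Vec.Functional using (Vector; replicate; updateAt)
open import Function.Base using (const)
open import Relation.Binary.Core using (Rel)
open import Relation.Binary.Definitions using (tri<; tri≈; tri>)
open import Relation.Binary.PropositionalEquality.Core as ≡ using (_≡_)
open import Relation.Binary.Structures using (IsStrictTotalOrder)
import Relation.Binary.Construct.StrictToNonStrict as ToNonStrict
open import Relation.Nullary.Decidable.Core using (yes; no)
open import Relation.Nullary.Negation.Core using (¬_)

------------------------------------------------------------------------
-- Real numbers

-- The standard library has no type of real numbers, so ℝ is presented
-- axiomatically, as a Dedekind-complete totally ordered field.
-- Classically such a field is unique up to isomorphism.

record CompleteOrderedField : Set₁ where
  field
    commutativeRing : CommutativeRing 0ℓ 0ℓ

  open CommutativeRing commutativeRing public

  infix  4 _<_
  infix  8 _⁻¹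
  infixl 7 _/_

  field
    _<_                : Rel Carrier 0ℓ
    isStrictTotalOrder : IsStrictTotalOrder _≈_ _<_

  open ToNonStrict _≈_ _<_ public using (_≤_)

  IsUpperBound : (Carrier → Set) → Carrier → Set
  IsUpperBound S b = ∀ x → S x → x ≤ b

  -- The second component says that no y < s is an upper bound of S, in
  -- the positive form that names an element of S exceeding y.
  IsSupremum : (Carrier → Set) → Carrier → Set
  IsSupremum S s = IsUpperBound S s × (∀ y → y < s → ∃[ x ] S x × y < x)

  field
    0<1        : 0# < 1#
    +-monoˡ-<  : ∀ z {x y} → x < y → x + z < y + z
    *-pos      : ∀ {x y} → 0# < x → 0# < y → 0# < x * y
    _⁻¹        : Carrier → Carrier        -- 0# ⁻¹ is unspecified
    ⁻¹-inverse : ∀ x → ¬ (x ≈ 0#) → x * x ⁻¹ ≈ 1#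
    complete   : (S : Carrier → Set) → ∃ S → ∃ (IsUpperBound S) →
                 ∃ (IsSupremum S)

  open IsStrictTotalOrder isStrictTotalOrder public
    using (compare; _<?_; <-respʳ-≈; <-respˡ-≈)
    renaming (trans to <-trans; irrefl to <-irrefl)
  open SemiringMult semiring public using (×1-homo-*; ×-homo-+)
    renaming (_×_ to _·_)
  open SemiringExp semiring public using (_^_)

  _/_ : Carrier → Carrier → Carrier
  x / y = x * y ⁻¹

  fromℕ : ℕ → Carrier
  fromℕ k = k · 1#

------------------------------------------------------------------------
-- Order properties and the Archimedean property

module RealProperties (ℛ : CompleteOrderedField) where
  open CompleteOrderedField ℛ

  ≤-<-trans : ∀ {x y z} → x ≤ y → y < z → x < z
  ≤-<-trans (inj₁ x<y) y<z = <-trans x<y y<z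
  ≤-<-trans (inj₂ x≈y) y<z = <-respˡ-≈ (sym x≈y) y<z

  <-≤-trans : ∀ {x y z} → x < y → y ≤ z → x < z
  <-≤-trans x<y (inj₁ y<z) = <-trans x<y y<z
  <-≤-trans x<y (inj₂ y≈z) = <-respʳ-≈ y≈z x<y

  ≤-trans : ∀ {x y z} → x ≤ y → y ≤ z → x ≤ z
  ≤-trans (inj₁ x<y) y≤z        = inj₁ (<-≤-trans x<y y≤z)
  ≤-trans (inj₂ x≈y) (inj₁ y<z) = inj₁ (<-respˡ-≈ (sym x≈y) y<z)
  ≤-trans (inj₂ x≈y) (inj₂ y≈z) = inj₂ (trans x≈y y≈z)

  ≮⇒≥ : ∀ {x y} → ¬ (x < y) → y ≤ x
  ≮⇒≥ {x} {y} x≮y with compare x y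
  ... | tri< x<y _ _ = ⊥-elim (x≮y x<y)
  ... | tri≈ _ x≈y _ = inj₂ (sym x≈y)
  ... | tri> _ _ y<x = inj₁ y<x

  cancel : ∀ x y → (x - y) + y ≈ x
  cancel x y =
    trans (+-assoc x (- y) y)
          (trans (+-congˡ (-‿inverseˡ y)) (+-identityʳ x))

  x<1+x : ∀ x → x < 1# + x
  x<1+x x = <-respˡ-≈ (+-identityˡ x) (+-monoˡ-< x 0<1)

  *-monoˡ-< : ∀ z {x y} → 0# < z → x < y → z * x < z * y
  *-monoˡ-< z {x} {y} 0<z x<y =
    <-respʳ-≈ eq (<-respˡ-≈ (+-identityˡ (z * x))
      (+-monoˡ-< (z * x) (*-pos 0<z 0<y-x)))
    where
    0<y-x : 0# < y - x
    0<y-x = <-respˡ-≈ (-‿inverseʳ x) (+-monoˡ-< (- x) x<y)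

    eq : z * (y - x) + z * x ≈ z * y
    eq = trans (sym (distribˡ z (y - x) x)) (*-congˡ (cancel y x))

  *-monoˡ-≤ : ∀ z {x y} → 0# < z → x ≤ y → z * x ≤ z * y
  *-monoˡ-≤ z 0<z (inj₁ x<y) = inj₁ (*-monoˡ-< z 0<z x<y)
  *-monoˡ-≤ z 0<z (inj₂ x≈y) = inj₂ (*-congˡ x≈y)

  fromℕ-nonneg : ∀ k → 0# ≤ fromℕ k
  fromℕ-nonneg zero    = inj₂ refl
  fromℕ-nonneg (suc k) = inj₁ (≤-<-trans (fromℕ-nonneg k) (x<1+x (fromℕ k)))

  fromℕ-suc-pos : ∀ k → 0# < fromℕ (suc k)
  fromℕ-suc-pos k = ≤-<-trans (fromℕ-nonneg k) (x<1+x (fromℕ k))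

  fromℕ-mono-< : ∀ {j k} → j ℕ.< k → fromℕ j < fromℕ k
  fromℕ-mono-< {zero}  {suc k} _         = fromℕ-suc-pos k
  fromℕ-mono-< {suc j} {suc k} (s≤s j<k) =
    <-respʳ-≈ (+-comm (fromℕ k) 1#) (<-respˡ-≈ (+-comm (fromℕ j) 1#)
      (+-monoˡ-< 1# (fromℕ-mono-< j<k)))

  archimedean : ∀ x → ∃[ k ] x < fromℕ k
  archimedean x with x <? 0#
  ... | yes x<0 = 0 , x<0
  ... | no  x≮0 = search
    where
    S : Carrier → Set
    S t = ∃[ k ] t ≈ fromℕ k × fromℕ k ≤ x

    sup : ∃ (IsSupremum S)
    sup = complete S (0# , 0 , refl , ≮⇒≥ x≮0)
                     (x , λ { t (k , t≈k , k≤x) → ≤-trans (inj₂ t≈k) k≤x })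

    s : Carrier
    s = proj₁ sup

    s-1<s : s - 1# < s
    s-1<s = <-respʳ-≈ (trans (+-comm 1# (s - 1#)) (cancel s 1#))
                      (x<1+x (s - 1#))

    search : ∃[ k ] x < fromℕ k
    search with proj₂ (proj₂ sup) (s - 1#) s-1<s
    ... | t , (k , t≈k , k≤x) , s-1<t with x <? fromℕ (suc k)
    ...   | yes x<1+k = suc k , x<1+k
    ...   | no  x≮1+k = ⊥-elim (<-irrefl refl (<-≤-trans s<1+k 1+k≤s))
      where
      s<1+k : s < fromℕ (suc k)
      s<1+k = <-respˡ-≈ (cancel s 1#) (<-respʳ-≈ (+-comm (fromℕ k) 1#)
                (+-monoˡ-< 1# (<-respʳ-≈ t≈k s-1<t)))

      1+k≤s : fromℕ (suc k) ≤ s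
      1+k≤s = proj₁ (proj₂ sup) (fromℕ (suc k))
                    (suc k , refl , ≮⇒≥ x≮1+k)

  0<2^ : ∀ k → 0 ℕ.< 2 ℕ.^ k
  0<2^ k = ℕ.m^n>0 2 k

  n<2^n : ∀ k → k ℕ.< 2 ℕ.^ k
  n<2^n zero    = s≤s z≤n
  n<2^n (suc k) = ℕ.≤-trans (ℕ.+-mono-≤ (0<2^ k) (n<2^n k))
    (ℕ.≤-reflexive (≡.cong (2 ℕ.^ k ℕ.+_) (≡.sym (ℕ.+-identityʳ (2 ℕ.^ k)))))

  <2^ : ∀ x → ∃[ k ] x < fromℕ (2 ℕ.^ k)
  <2^ x with archimedean x
  ... | k , x<k = k , <-trans x<k (fromℕ-mono-< (n<2^n k))

  0<fromℕ2^ : ∀ k → 0# < fromℕ (2 ℕ.^ k)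
  0<fromℕ2^ k = fromℕ-mono-< (0<2^ k)

------------------------------------------------------------------------
-- Binary logarithm

module Logarithm (ℛ : CompleteOrderedField) where
  open CompleteOrderedField ℛ
  open RealProperties ℛ

  -- t = (a - b) / (q + 1) is a rational number with 2 ^ t ≤ y.
  BelowLog : Carrier → Carrier → Set
  BelowLog y t = ∃[ a ] ∃[ b ] ∃[ q ]
    fromℕ (suc q) * t + fromℕ b ≈ fromℕ a ×
    fromℕ (2 ℕ.^ a) ≤ fromℕ (2 ℕ.^ b) * y ^ suc q

  nonempty : ∀ {y} → 0# < y → ∃ (BelowLog y)
  nonempty {y} 0<y with <2^ (y ⁻¹)
  ... | b , y⁻¹<2^b =
    - fromℕ b , 0 , b , 0 ,
    trans (+-congʳ (trans (*-congʳ (+-identityʳ 1#)) (*-identityˡ (- fromℕ b))))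
          (-‿inverseˡ (fromℕ b)) ,
    inj₁ (<-respˡ-≈ (trans (⁻¹-inverse y y≉0) (sym (+-identityʳ 1#)))
         (<-respʳ-≈ (trans (*-comm y _) (*-congˡ (sym (*-identityʳ y))))
           (*-monoˡ-< y 0<y y⁻¹<2^b)))
    where
    y≉0 : ¬ (y ≈ 0#)
    y≉0 y≈0 = <-irrefl (sym y≈0) 0<y

  ^-bound : ∀ {y} k → 0# < y → y < fromℕ (2 ℕ.^ k) →
            ∀ q → y ^ q ≤ fromℕ (2 ℕ.^ (q ℕ.* k))
  ^-bound k 0<y y<2^k zero = inj₂ (sym (+-identityʳ 1#))
  ^-bound {y} k 0<y y<2^k (suc q) =
    ≤-trans (*-monoˡ-≤ y 0<y (^-bound k 0<y y<2^k q))
      (inj₁ (<-respˡ-≈ (*-comm _ y) (<-respʳ-≈ eq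
        (*-monoˡ-< _ (0<fromℕ2^ (q ℕ.* k)) y<2^k))))
    where
    eq : fromℕ (2 ℕ.^ (q ℕ.* k)) * fromℕ (2 ℕ.^ k) ≈
         fromℕ (2 ℕ.^ (suc q ℕ.* k))
    eq = trans (*-comm _ _) (trans (sym (×1-homo-* (2 ℕ.^ k) _))
           (reflexive (≡.cong fromℕ (≡.sym (ℕ.^-distribˡ-+-* 2 k (q ℕ.* k))))))

  bounded : ∀ {y} → 0# < y → ∃ (IsUpperBound (BelowLog y))
  bounded {y} 0<y with <2^ y
  ... | k , y<2^k = fromℕ k , bound
    where
    bound : IsUpperBound (BelowLog y) (fromℕ k)
    bound t (a , b , q , eq , 2^a≤) = ≮⇒≥ λ k<t →
      <-irrefl refl (<-≤-trans
        (fromℕ-mono-< (ℕ.^-monoʳ-< 2 (s≤s (s≤s z≤n)) (exponent k<t)))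
        2^a≤2^c)
      where
      c : ℕ
      c = b ℕ.+ suc q ℕ.* k

      2^a≤2^c : fromℕ (2 ℕ.^ a) ≤ fromℕ (2 ℕ.^ c)
      2^a≤2^c = ≤-trans 2^a≤ (≤-trans
        (*-monoˡ-≤ _ (0<fromℕ2^ b) (^-bound k 0<y y<2^k (suc q)))
        (inj₂ (trans (sym (×1-homo-* (2 ℕ.^ b) _))
          (reflexive (≡.cong fromℕ
            (≡.sym (ℕ.^-distribˡ-+-* 2 b (suc q ℕ.* k))))))))

      c<a : fromℕ k < t → fromℕ c < fromℕ a
      c<a k<t = <-respˡ-≈
        (trans (+-congʳ (sym (×1-homo-* (suc q) k)))
          (trans (+-comm _ (fromℕ b)) (sym (×-homo-+ 1# b (suc q ℕ.* k)))))
        (<-respʳ-≈ eq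
          (+-monoˡ-< (fromℕ b) (*-monoˡ-< _ (fromℕ-suc-pos q) k<t)))

      exponent : fromℕ k < t → c ℕ.< a
      exponent k<t with c ℕ.<? a
      ... | yes c<a′ = c<a′
      ... | no  c≮a with ℕ.m≤n⇒m<n∨m≡n (ℕ.≮⇒≥ c≮a)
      ...   | inj₁ a<c = ⊥-elim
              (<-irrefl refl (<-trans (c<a k<t) (fromℕ-mono-< a<c)))
      ...   | inj₂ a≡c = ⊥-elim
              (<-irrefl (reflexive (≡.cong fromℕ (≡.sym a≡c))) (c<a k<t))

  -- log₂ y is the supremum of the rationals t with 2 ^ t ≤ y; as usual,
  -- it is extended by 0 to nonpositive arguments.
  log₂ : Carrier → Carrier
  log₂ y with 0# <? y
  ... | yes 0<y = proj₁ (complete (BelowLog y) (nonempty 0<y) (bounded 0<y))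
  ... | no  _   = 0#

  log₂-supremum : ∀ {y} → 0# < y → IsSupremum (BelowLog y) (log₂ y)
  log₂-supremum {y} 0<y with 0# <? y
  ... | yes 0<y′ =
    proj₂ (complete (BelowLog y) (nonempty 0<y′) (bounded 0<y′))
  ... | no  0≮y  = ⊥-elim (0≮y 0<y)

------------------------------------------------------------------------
-- Finite directed graphs

-- (v , u) is an edge precisely when u occurs in out v.  Listing N_out(v)
-- without repetition also fixes the order in which the algorithm scans
-- it; all orders are covered by varying the list.  Self-loops are allowed.
record Digraph (n : ℕ) : Set where
  field
    out        : Fin n → List (Fin n)
    out-unique : ∀ v → Unique (out v)

  deg : Fin n → ℕ
  deg v = length (out v)

  edges : ℕ
  edges = sum (map deg (allFin n))

------------------------------------------------------------------------
-- FIFO-FwdPush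

-- Running times of the elementary operations; being fixed numbers, they
-- express that each operation takes O(1) time.
record Costs : Set where
  field
    arithmetic comparison assignment queueOp membership : ℕ

module FIFO-FwdPush
  (ℛ : CompleteOrderedField) (κ : Costs) {n : ℕ} (G : Digraph n)
  (α : CompleteOrderedField.Carrier ℛ) (s : Fin n)
  (rmax : CompleteOrderedField.Carrier ℛ) where

  open CompleteOrderedField ℛ
  open Costs κ
  open Digraph G
  open DecMembership (Fin._≟_ {n}) using (_∈?_)

  record State : Set where
    constructor state
    field
      reserve : Vector Carrier n
      residue : Vector Carrier n
      queue   : List (Fin n)
      clock   : ℕ

  open State public

  tick : ℕ → State → State
  tick c σ = record σ { clock = clock σ ℕ.+ c }

  initial : State
  initial = state (replicate n 0#)
                  (updateAt (replicate n 0#) s (const 1#))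
                  [ s ]
                  ((n ℕ.+ n ℕ.+ 1) ℕ.* assignment ℕ.+ queueOp)

  enqueue : Fin n → State → State
  enqueue u σ = tick queueOp (record σ { queue = queue σ ++ [ u ] })

  enqueueIfAbsent : Fin n → State → State
  enqueueIfAbsent u σ with u ∈? queue σ
  ... | yes _ = tick membership σ
  ... | no  _ = enqueue u (tick membership σ)

  activate : Fin n → State → State
  activate u σ with fromℕ (deg u) * rmax <? residue σ u
  ... | yes _ = enqueueIfAbsent u (tick (arithmetic ℕ.+ comparison) σ)
  ... | no  _ = tick (arithmetic ℕ.+ comparison) σ

  relax : Fin n → State → Fin n → State
  relax v σ u = activate u (tick (4 ℕ.* arithmetic ℕ.+ assignment) record σ
    { residue = updateAt (residue σ) u
                  (_+ ((1# - α) * residue σ v) / fromℕ (deg v)) })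

  gain : Fin n → State → State
  gain v σ = tick (2 ℕ.* arithmetic ℕ.+ assignment) record σ
    { reserve = updateAt (reserve σ) v (_+ α * residue σ v) }

  clear : Fin n → State → State
  clear v σ = tick assignment record σ
    { residue = updateAt (residue σ) v (const 0#) }

  -- The node v has already been removed from the queue.
  push : Fin n → State → State
  push v σ = clear v (foldl (relax v) (gain v σ) (out v))

  -- σ ⇓ τ : the while loop entered in state σ terminates in state τ.
  -- A round costs one queue operation for the emptiness test and one for
  -- removing the front node; the final, failing test costs one.
  infix 4 _⇓_
  data _⇓_ : State → State → Set where
    stop : ∀ {σ} → queue σ ≡ [] → σ ⇓ tick queueOp σ
    loop : ∀ {σ τ v q} → queue σ ≡ v ∷ q →
           push v (tick (queueOp ℕ.+ queueOp) (record σ { queue = q })) ⇓ τ →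
           σ ⇓ τ

{-# OPTIONS --safe #-}
module Submission where

-- Split the execution into rounds, each pushing exactly the nodes queued when
-- it starts.  Nodes outside the queue have residue at most d_v rmax, queued
-- nodes at least proportionally as much, so a round pushing nodes of total
-- degree Y lowers the total residue Φ at its start by at least a constant
-- times (Y / m) Φ, and also by at least a constant times Y rmax = (Y / m) λ.
-- Hence degree O(m) is pushed while Φ halves; after log₂ (1 / λ) halvings
-- Φ ≤ λ, and the second bound limits the remaining degree to O(m).

open import Defs
import Algebra.Properties.CommutativeMonoid.Sum as MonoidSum
import Algebra.Properties.Group as GroupProperties
import Algebra.Solver.Ring.NaturalCoefficients.Default as SemiringSolver
open import Data.Empty using (⊥-elim)
open import Data.Fin.Base using (Fin; zero; suc)
import Data.Fin.Properties as Fin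
open import Data.List.Base
  using (List; []; _∷_; [_]; _++_; length; map; allFin; tabulate; foldl)
open import Data.List.Membership.Propositional using (_∈_; _∉_)
open import Data.List.Membership.Propositional.Properties
  using (∈-++⁺ˡ; ∈-++⁺ʳ; ∈-++⁻; ∈-∃++)
import Data.List.Membership.DecPropositional as DecMembership
import Data.List.Properties as List
open import Data.List.Relation.Unary.All using ([]; _∷_)
open import Data.List.Relation.Unary.AllPairs as AllPairs using ([]; _∷_)
open import Data.List.Relation.Unary.Any using (here; there)
open import Data.List.Relation.Unary.Unique.Propositional using (Unique)
import Data.List.Relation.Unary.Unique.Propositional.Properties as Unique
open import Data.Nat.Base as ℕ using (ℕ; zero; suc; z≤n; s≤s)
open import Data.Nat.ListAction using (sum)
import Data.Nat.Properties as ℕ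
import Data.Nat.Solver
open import Data.Product.Base using (_×_; _,_; ∃-syntax; proj₁; proj₂)
open import Data.Sum.Base using (_⊎_; inj₁; inj₂)
open import Data.Vec.Functional using (Vector; updateAt)
open import Data.Vec.Functional.Properties
  using (updateAt-updates; updateAt-minimal)
open import Function.Base using (_∘_; const; id)
open import Relation.Binary.Bundles using (StrictPartialOrder)
open import Relation.Binary.PropositionalEquality.Core as ≡ using (_≡_; _≢_)
open import Relation.Binary.Structures using (IsStrictTotalOrder)
open import Relation.Nullary.Decidable.Core using (yes; no)
open import Relation.Nullary.Negation.Core using (¬_)

-- A round may push few edges, so rounds are not counted: the pushed degree is paid for by a
-- potential. FIFO order enters in one way only. A waiting node cannot lose credit before it is
-- popped, and the nodes of a round are popped before any node appended during it; hence the credits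
-- popped in a round add up to at least what its nodes held at its start. Thresholds are
-- proportional to degree, so comparing credit per unit of degree inside and outside the queue gives
-- the nodes of a round at least a fixed fraction of their proportional share of Φ. The bound in
-- terms of Φ alone would permit endless halving; the bound in terms of λ closes the last phase. The
-- run has to be exhibited as a finite derivation, so termination gets its own argument: every push
-- lowers the credit by a fixed amount. Powers of two stand in for the logarithm until the very end.

module ℕR = ℕ.≤-Reasoning
module ℕS = Data.Nat.Solver.+-*-Solver

-- Arithmetic of ordered fields

module OrderedField (ℛ : CompleteOrderedField) where
  open CompleteOrderedField ℛ hiding (zero)
  open RealProperties ℛ
  open SemiringSolver commutativeSemiring public
    using (solve; _:=_; _:+_; _:*_)
  open GroupProperties +-group public
    using () renaming (∙-cancelʳ to +-cancelʳ)

  strictPartialOrder : StrictPartialOrder _ _ _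
  strictPartialOrder = record
    { isStrictPartialOrder =
        IsStrictTotalOrder.isStrictPartialOrder isStrictTotalOrder }

  open import Relation.Binary.Reasoning.StrictPartialOrder strictPartialOrder

  ≤-refl : ∀ {x} → x ≤ x
  ≤-refl = inj₂ refl

  +-monoˡ-≤ : ∀ z {x y} → x ≤ y → x + z ≤ y + z
  +-monoˡ-≤ z (inj₁ x<y) = inj₁ (+-monoˡ-< z x<y)
  +-monoˡ-≤ z (inj₂ x≈y) = inj₂ (+-congʳ x≈y)

  +-mono-≤ : ∀ {x y u v} → x ≤ y → u ≤ v → x + u ≤ y + v
  +-mono-≤ {x} {y} {u} {v} x≤y u≤v = begin
    x + u ≤⟨ +-monoˡ-≤ u x≤y ⟩
    y + u ≈⟨ +-comm y u ⟩
    u + y ≤⟨ +-monoˡ-≤ y u≤v ⟩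
    v + y ≈⟨ +-comm v y ⟩
    y + v ∎

  x≤x+y : ∀ {x y} → 0# ≤ y → x ≤ x + y
  x≤x+y {x} 0≤y =
    ≤-trans (inj₂ (sym (+-identityʳ x))) (+-mono-≤ (≤-refl {x}) 0≤y)

  +-nonneg : ∀ {x y} → 0# ≤ x → 0# ≤ y → 0# ≤ x + y
  +-nonneg 0≤x 0≤y = ≤-trans 0≤x (x≤x+y 0≤y)

  +-cancelʳ-≤ : ∀ z {x y} → x + z ≤ y + z → x ≤ y
  +-cancelʳ-≤ z {x} {y} x+z≤y+z = begin
    x               ≈⟨ undo x ⟨
    (x + z) + (- z) ≤⟨ +-monoˡ-≤ (- z) x+z≤y+z ⟩
    (y + z) + (- z) ≈⟨ undo y ⟩
    y               ∎
    where
    undo : ∀ w → (w + z) + (- z) ≈ w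
    undo w = trans (+-assoc w z (- z))
                   (trans (+-congˡ (-‿inverseʳ z)) (+-identityʳ w))

  -- Turns x ≤ y into any inequality p ≤ q with q - p ≈ y - x; the last
  -- premise is subtraction-free, hence within reach of the semiring solver.
  ≤-from : ∀ {x y p q} → x ≤ y → p + y ≈ q + x → p ≤ q
  ≤-from {x} {y} {p} {q} x≤y eq = +-cancelʳ-≤ y (begin
    p + y ≈⟨ eq ⟩
    q + x ≤⟨ +-mono-≤ ≤-refl x≤y ⟩
    q + y ∎)

  *-monoʳ-≤ : ∀ {z x y} → 0# ≤ z → x ≤ y → z * x ≤ z * y
  *-monoʳ-≤ {z} (inj₁ 0<z) x≤y = *-monoˡ-≤ z 0<z x≤y
  *-monoʳ-≤ {z} {x} {y} (inj₂ 0≈z) _ = inj₂ (trans (zero* x) (sym (zero* y)))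
    where
    zero* : ∀ w → z * w ≈ 0#
    zero* w = trans (*-congʳ (sym 0≈z)) (zeroˡ w)

  *-mono-≤ : ∀ {x y u v} → 0# ≤ x → 0# ≤ v → x ≤ y → u ≤ v → x * u ≤ y * v
  *-mono-≤ {x} {y} {u} {v} 0≤x 0≤v x≤y u≤v = begin
    x * u ≤⟨ *-monoʳ-≤ 0≤x u≤v ⟩
    x * v ≈⟨ *-comm x v ⟩
    v * x ≤⟨ *-monoʳ-≤ 0≤v x≤y ⟩
    v * y ≈⟨ *-comm v y ⟩
    y * v ∎

  *-nonneg : ∀ {x y} → 0# ≤ x → 0# ≤ y → 0# ≤ x * y
  *-nonneg {x} {y} 0≤x 0≤y =
    ≤-trans (inj₂ (sym (zeroʳ x))) (*-monoʳ-≤ 0≤x 0≤y)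

  ≤⇒≯ : ∀ {x y} → x ≤ y → ¬ (y < x)
  ≤⇒≯ x≤y y<x = <-irrefl refl (≤-<-trans x≤y y<x)

  fromℕ-mono-≤ : ∀ {j k} → j ℕ.≤ k → fromℕ j ≤ fromℕ k
  fromℕ-mono-≤ j≤k with ℕ.m≤n⇒m<n∨m≡n j≤k
  ... | inj₁ j<k    = inj₁ (fromℕ-mono-< j<k)
  ... | inj₂ ≡.refl = ≤-refl

  fromℕ-cancel-≤ : ∀ {j k} → fromℕ j ≤ fromℕ k → j ℕ.≤ k
  fromℕ-cancel-≤ j≤k = ℕ.≮⇒≥ (≤⇒≯ j≤k ∘ fromℕ-mono-<)

  fromℕ-1 : fromℕ 1 ≈ 1#
  fromℕ-1 = +-identityʳ 1#

  1≤fromℕ : ∀ {k} → 1 ℕ.≤ k → 1# ≤ fromℕ k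
  1≤fromℕ 1≤k = ≤-trans (inj₂ (sym fromℕ-1)) (fromℕ-mono-≤ 1≤k)

  fromℕ-+ : ∀ j k → fromℕ (j ℕ.+ k) ≈ fromℕ j + fromℕ k
  fromℕ-+ = ×-homo-+ 1#

  pos⇒≉0 : ∀ {x} → 0# < x → ¬ (x ≈ 0#)
  pos⇒≉0 0<x x≈0 = <-irrefl (sym x≈0) 0<x

  ⁻¹-pos : ∀ {x} → 0# < x → 0# < x ⁻¹
  ⁻¹-pos {x} 0<x with 0# <? x ⁻¹
  ... | yes 0<x⁻¹ = 0<x⁻¹
  ... | no  0≮x⁻¹ = ⊥-elim (≤⇒≯ 1≤0 0<1)
    where
    1≤0 : 1# ≤ 0#
    1≤0 = begin
      1#       ≈⟨ ⁻¹-inverse x (pos⇒≉0 0<x) ⟨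
      x * x ⁻¹ ≤⟨ *-monoʳ-≤ (inj₁ 0<x) (≮⇒≥ 0≮x⁻¹) ⟩
      x * 0#   ≈⟨ zeroʳ x ⟩
      0#       ∎

-- Sums over all nodes and over lists of nodes

module FiniteSums (ℛ : CompleteOrderedField) where
  open CompleteOrderedField ℛ hiding (zero)
  open RealProperties ℛ
  open OrderedField ℛ
  open import Relation.Binary.Reasoning.StrictPartialOrder strictPartialOrder
  open MonoidSum +-commutativeMonoid public
    using () renaming (sum to Σ; sum-cong-≋ to Σ-cong)

  Σ-nonneg : ∀ {n} (f : Vector Carrier n) → (∀ w → 0# ≤ f w) → 0# ≤ Σ f
  Σ-nonneg {zero}  f 0≤f = ≤-refl
  Σ-nonneg {suc n} f 0≤f = +-nonneg (0≤f zero) (Σ-nonneg (f ∘ suc) (0≤f ∘ suc))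

  Σ-mono : ∀ {n} (f g : Vector Carrier n) → (∀ w → f w ≤ g w) → Σ f ≤ Σ g
  Σ-mono {zero}  f g f≤g = ≤-refl
  Σ-mono {suc n} f g f≤g =
    +-mono-≤ (f≤g zero) (Σ-mono (f ∘ suc) (g ∘ suc) (f≤g ∘ suc))

  fromℕ≤Σ : ∀ {n} (f : Vector Carrier n) → (∀ w → 1# ≤ f w) → fromℕ n ≤ Σ f
  fromℕ≤Σ {zero}  f 1≤f = ≤-refl
  fromℕ≤Σ {suc n} f 1≤f = +-mono-≤ (1≤f zero) (fromℕ≤Σ (f ∘ suc) (1≤f ∘ suc))

  Σ-updateAt : ∀ {n} (f : Vector Carrier n) i g →
               Σ (updateAt f i g) + f i ≈ Σ f + g (f i)
  Σ-updateAt {suc n} f zero g =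
    solve 3 (λ x s y → y :+ s :+ x := x :+ s :+ y) refl
      (f zero) (Σ (f ∘ suc)) (g (f zero))
  Σ-updateAt {suc n} f (suc i) g = begin-equality
    f zero + Σ (updateAt (f ∘ suc) i g) + f (suc i)   ≈⟨ +-assoc _ _ _ ⟩
    f zero + (Σ (updateAt (f ∘ suc) i g) + f (suc i)) ≈⟨ +-congˡ (Σ-updateAt (f ∘ suc) i g) ⟩
    f zero + (Σ (f ∘ suc) + g (f (suc i)))            ≈⟨ +-assoc _ _ _ ⟨
    f zero + Σ (f ∘ suc) + g (f (suc i))              ∎

  Σ-const0 : ∀ n → Σ {n} (const 0#) ≈ 0#
  Σ-const0 zero    = refl
  Σ-const0 (suc n) = trans (+-identityˡ _) (Σ-const0 n)

  Σ-*ˡ : ∀ {n} c (f : Vector Carrier n) → Σ (λ w → c * f w) ≈ c * Σ f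
  Σ-*ˡ {zero}  c f = sym (zeroʳ c)
  Σ-*ˡ {suc n} c f =
    trans (+-congˡ (Σ-*ˡ c (f ∘ suc))) (sym (distribˡ c _ _))

  Σ-fromℕ : ∀ {n} (f : Fin n → ℕ) →
            Σ (fromℕ ∘ f) ≈ fromℕ (sum (map f (allFin n)))
  Σ-fromℕ {n} f = trans (go f)
    (reflexive (≡.cong (fromℕ ∘ sum) (≡.sym (List.map-tabulate id f))))
    where
    go : ∀ {n} (f : Fin n → ℕ) → Σ (fromℕ ∘ f) ≈ fromℕ (sum (tabulate f))
    go {zero}  f = refl
    go {suc n} f = trans (+-congˡ (go (f ∘ suc))) (sym (fromℕ-+ (f zero) _))

  Σ[_] : ∀ {n} → List (Fin n) → Vector Carrier n → Carrier
  Σ[ []     ] f = 0#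
  Σ[ w ∷ ws ] f = f w + Σ[ ws ] f

  Σ[]-mono : ∀ {n} (ws : List (Fin n)) {f g} → (∀ {w} → w ∈ ws → f w ≤ g w) →
             Σ[ ws ] f ≤ Σ[ ws ] g
  Σ[]-mono []       f≤g = ≤-refl
  Σ[]-mono (w ∷ ws) f≤g = +-mono-≤ (f≤g (here ≡.refl)) (Σ[]-mono ws (f≤g ∘ there))

  Σ[]-zero : ∀ {n} (ws : List (Fin n)) → Σ[ ws ] (const 0#) ≈ 0#
  Σ[]-zero []       = refl
  Σ[]-zero (w ∷ ws) = trans (+-identityˡ _) (Σ[]-zero ws)

  -- Without subtraction, this compares the sums of f and g over the complement of ws. With the
  -- credit for f and the threshold for g it turns the bound on nodes outside the queue into a lower
  -- bound on the credit inside.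
  Σ-exchange : ∀ {n} {ws : List (Fin n)} → Unique ws → (f g : Vector Carrier n) →
               (∀ {w} → w ∉ ws → f w ≤ g w) →
               Σ f + Σ[ ws ] g ≤ Σ[ ws ] f + Σ g
  Σ-exchange [] f g f≤g = begin
    Σ f + 0# ≈⟨ +-comm _ _ ⟩
    0# + Σ f ≤⟨ +-mono-≤ ≤-refl (Σ-mono f g (λ w → f≤g λ ())) ⟩
    0# + Σ g ∎
  Σ-exchange {n} {v ∷ ws} uniq@(_ ∷ uniq′) f g f≤g =
    ≤-from (≤-trans ih (+-mono-≤ (Σ[]-mono ws unchanged) ≤-refl)) eq
    where
    -- Overwriting f by g at v makes the hypothesis hold outside the shorter list; v ∉ ws leaves
    -- `Σ[ ws ] f` unchanged.
    f′ : Vector Carrier n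
    f′ = updateAt f v (const (g v))

    f′≤g : ∀ {w} → w ∉ ws → f′ w ≤ g w
    f′≤g {w} w∉ws with w Fin.≟ v
    ... | yes ≡.refl = inj₂ (reflexive (updateAt-updates v f))
    ... | no  w≢v    = ≤-trans (inj₂ (reflexive (updateAt-minimal w v f w≢v)))
      (f≤g λ { (here w≡v) → w≢v w≡v ; (there w∈ws) → w∉ws w∈ws })

    ih : Σ f′ + Σ[ ws ] g ≤ Σ[ ws ] f′ + Σ g
    ih = Σ-exchange uniq′ f′ g f′≤g

    unchanged : ∀ {w} → w ∈ ws → f′ w ≤ f w
    unchanged {w} w∈ws = inj₂ (reflexive (updateAt-minimal w v f
      λ { ≡.refl → Unique.Unique[x∷xs]⇒x∉xs uniq w∈ws }))

    eq : Σ f + (g v + Σ[ ws ] g) + (Σ[ ws ] f + Σ g) ≈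
         f v + Σ[ ws ] f + Σ g + (Σ f′ + Σ[ ws ] g)
    eq = begin-equality
      Σ f + (g v + Σ[ ws ] g) + (Σ[ ws ] f + Σ g)
        ≈⟨ solve 5 (λ a b c d e → a :+ (b :+ c) :+ (d :+ e) :=
                                  (a :+ b) :+ (c :+ (d :+ e))) refl
             (Σ f) (g v) (Σ[ ws ] g) (Σ[ ws ] f) (Σ g) ⟩
      (Σ f + g v) + (Σ[ ws ] g + (Σ[ ws ] f + Σ g))
        ≈⟨ +-congʳ (Σ-updateAt f v (const (g v))) ⟨
      (Σ f′ + f v) + (Σ[ ws ] g + (Σ[ ws ] f + Σ g))
        ≈⟨ solve 5 (λ a b c d e → (a :+ b) :+ (c :+ (d :+ e)) :=
                                  b :+ d :+ e :+ (a :+ c)) refl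
             (Σ f′) (f v) (Σ[ ws ] g) (Σ[ ws ] f) (Σ g) ⟩
      f v + Σ[ ws ] f + Σ g + (Σ f′ + Σ[ ws ] g) ∎

  Σ[]≤Σ : ∀ {n} {ws : List (Fin n)} → Unique ws → (g : Vector Carrier n) →
          (∀ w → 0# ≤ g w) → Σ[ ws ] g ≤ Σ g
  Σ[]≤Σ {n} {ws} uniq g 0≤g = begin
    Σ[ ws ] g                    ≈⟨ +-identityˡ _ ⟨
    0# + Σ[ ws ] g               ≈⟨ +-congʳ (Σ-const0 n) ⟨
    Σ {n} (const 0#) + Σ[ ws ] g ≤⟨ Σ-exchange uniq (const 0#) g (λ {w} _ → 0≤g w) ⟩
    Σ[ ws ] (const 0#) + Σ g     ≈⟨ +-congʳ (Σ[]-zero ws) ⟩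
    0# + Σ g                     ≈⟨ +-identityˡ _ ⟩
    Σ g                          ∎

-- Constants derived from α

module Parameters (ℛ : CompleteOrderedField)
  (α : CompleteOrderedField.Carrier ℛ)
  (0<α : CompleteOrderedField._<_ ℛ (CompleteOrderedField.0# ℛ) α)
  (α<1 : CompleteOrderedField._<_ ℛ α (CompleteOrderedField.1# ℛ)) where
  open CompleteOrderedField ℛ hiding (zero)
  open RealProperties ℛ
  open OrderedField ℛ
  open import Relation.Binary.Reasoning.StrictPartialOrder strictPartialOrder

  β : Carrier
  β = 1# - α

  -- α is cut into three equal parts. A push that passes on at most β φ(v) leaves α φ(v): two parts
  -- repay the credit of a node that re-appended itself, whose threshold is at most twice its
  -- residue, and the third is the net drop.
  ε : Carrier
  ε = α * fromℕ 3 ⁻¹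

  0<ε : 0# < ε
  0<ε = *-pos 0<α (⁻¹-pos (fromℕ-suc-pos 2))

  0≤ε : 0# ≤ ε
  0≤ε = inj₁ 0<ε

  3ε≈α : ε + ε + ε ≈ α
  3ε≈α = begin-equality
    ε + ε + ε
      ≈⟨ solve 2 (λ e u → e :* u :+ e :* u :+ e :* u :=
                          e :* ((u :+ (u :+ u)))) refl α (fromℕ 3 ⁻¹) ⟩
    -- The following steps rebuild `1# + (1# + (1# + 0#))`, the unfolding of `fromℕ 3`, multiplied
    -- out over t.
    α * (t + (t + t))
      ≈⟨ *-congˡ (+-cong (sym (*-identityˡ t))
           (+-cong (sym (*-identityˡ t)) (sym (*-identityˡ t)))) ⟩
    α * (1# * t + (1# * t + 1# * t))
      ≈⟨ *-congˡ (+-congˡ (+-congˡ (sym (+-identityʳ _)))) ⟩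
    α * (1# * t + (1# * t + (1# * t + 0#)))
      ≈⟨ *-congˡ (+-congˡ (+-congˡ (+-congˡ (sym (zeroˡ t))))) ⟩
    α * (1# * t + (1# * t + (1# * t + 0# * t)))
      ≈⟨ *-congˡ (trans (distribʳ t _ _) (+-congˡ (trans (distribʳ t _ _)
           (+-congˡ (distribʳ t _ _))))) ⟨
    α * (fromℕ 3 * t)
      ≈⟨ *-congˡ (⁻¹-inverse (fromℕ 3) (pos⇒≉0 (fromℕ-suc-pos 2))) ⟩
    α * 1#
      ≈⟨ *-identityʳ α ⟩
    α ∎
    where
    t : Carrier
    t = fromℕ 3 ⁻¹

  β+3ε≈1 : β + (ε + ε + ε) ≈ 1#
  β+3ε≈1 = trans (+-congˡ 3ε≈α) (cancel 1# α)

  0≤β : 0# ≤ β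
  0≤β = ≤-from (inj₁ α<1) (trans (+-identityˡ 1#) (sym (cancel 1# α)))

  β≤1 : β ≤ 1#
  β≤1 = ≤-trans (x≤x+y (+-nonneg (+-nonneg 0≤ε 0≤ε) 0≤ε)) (inj₂ β+3ε≈1)

  ε≤1 : ε ≤ 1#
  ε≤1 = begin
    ε                 ≤⟨ x≤x+y (+-nonneg (+-nonneg 0≤ε 0≤ε) 0≤β) ⟩
    ε + (ε + ε + β)   ≈⟨ solve 2 (λ e b → e :+ (e :+ e :+ b) := b :+ (e :+ e :+ e))
                           refl ε β ⟩
    β + (ε + ε + ε)   ≈⟨ β+3ε≈1 ⟩
    1#                ∎

-- Cost per unit of degree

module CostConstants (κ : Costs) where
  open Costs κ

  -- All costs are charged to degree: `relaxCost` per out-neighbour, `pushCost` and `stepCost` per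
  -- unit of deg v, the fixed part of a push being multiplied by deg v ≥ 1. `initialCost` is per
  -- edge and includes the last emptiness test.
  activateCost relaxCost pushCost stepCost initialCost : ℕ
  activateCost = (arithmetic ℕ.+ comparison) ℕ.+ (membership ℕ.+ queueOp)
  relaxCost    = (4 ℕ.* arithmetic ℕ.+ assignment) ℕ.+ activateCost
  pushCost     = (2 ℕ.* arithmetic ℕ.+ assignment) ℕ.+ assignment ℕ.+ relaxCost
  stepCost     = (queueOp ℕ.+ queueOp) ℕ.+ pushCost
  initialCost  = 3 ℕ.* assignment ℕ.+ 2 ℕ.* queueOp

-- A queued node v with a self-loop may be re-appended by its own push, after
-- which its residue is cleared; it then waits with a residue below the
-- threshold.  The credit φ repairs this: it agrees with the residue outside
-- the queue, is at least ε times the threshold inside it, and its sum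
-- decreases by ε φ(v) whenever v is pushed.
module PushAnalysis
  (ℛ : CompleteOrderedField) (κ : Costs) {n : ℕ} (G : Digraph n)
  (α : CompleteOrderedField.Carrier ℛ)
  (0<α : CompleteOrderedField._<_ ℛ (CompleteOrderedField.0# ℛ) α)
  (α<1 : CompleteOrderedField._<_ ℛ α (CompleteOrderedField.1# ℛ))
  (1≤deg : ∀ v → 1 ℕ.≤ Digraph.deg G v)
  (s : Fin n) (rmax : CompleteOrderedField.Carrier ℛ)
  (0<rmax : CompleteOrderedField._<_ ℛ (CompleteOrderedField.0# ℛ) rmax) where
  open CompleteOrderedField ℛ hiding (zero)
  open RealProperties ℛ
  open OrderedField ℛ
  open FiniteSums ℛ
  open Parameters ℛ α 0<α α<1
  open Costs κ
  open CostConstants κ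
  open Digraph G
  open FIFO-FwdPush ℛ κ G α s rmax
  open DecMembership (Fin._≟_ {n}) using (_∈?_)
  open import Relation.Binary.Reasoning.StrictPartialOrder strictPartialOrder
    hiding (start; stop)

  -- Thresholds, shares and a single activation

  θ : Vector Carrier n
  θ w = fromℕ (deg w) * rmax

  0≤θ : ∀ w → 0# ≤ θ w
  0≤θ w = *-nonneg (fromℕ-nonneg (deg w)) (inj₁ 0<rmax)

  εθ≤θ : ∀ w → ε * θ w ≤ θ w
  εθ≤θ w = ≤-trans (*-mono-≤ 0≤ε (0≤θ w) ε≤1 ≤-refl) (inj₂ (*-identityˡ (θ w)))

  0<deg : ∀ v → 0# < fromℕ (deg v)
  0<deg v = <-≤-trans 0<1 (1≤fromℕ (1≤deg v))

  share : Fin n → Carrier → Carrier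
  share v x = (β * x) / fromℕ (deg v)

  deg*share : ∀ v x → fromℕ (deg v) * share v x ≈ β * x
  deg*share v x = begin-equality
    d * (β * x * d ⁻¹) ≈⟨ solve 3 (λ d y i → d :* (y :* i) := y :* (d :* i)) refl
                            d (β * x) (d ⁻¹) ⟩
    β * x * (d * d ⁻¹) ≈⟨ *-congˡ (⁻¹-inverse d (pos⇒≉0 (0<deg v))) ⟩
    β * x * 1#         ≈⟨ *-identityʳ _ ⟩
    β * x              ∎
    where
    d : Carrier
    d = fromℕ (deg v)

  share-nonneg : ∀ v {x} → 0# ≤ x → 0# ≤ share v x
  share-nonneg v 0≤x = *-nonneg (*-nonneg 0≤β 0≤x) (inj₁ (⁻¹-pos (0<deg v)))

  share-mono : ∀ v {x y} → x ≤ y → share v x ≤ share v y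
  share-mono v {x} {y} x≤y = begin
    β * x * d⁻¹ ≈⟨ *-comm _ _ ⟩
    d⁻¹ * (β * x) ≤⟨ *-monoʳ-≤ (inj₁ (⁻¹-pos (0<deg v))) (*-monoʳ-≤ 0≤β x≤y) ⟩
    d⁻¹ * (β * y) ≈⟨ *-comm _ _ ⟩
    β * y * d⁻¹ ∎
    where
    d⁻¹ : Carrier
    d⁻¹ = fromℕ (deg v) ⁻¹

  share≤ : ∀ v {x} → 0# ≤ x → share v x ≤ x
  share≤ v {x} 0≤x = begin
    share v x                   ≈⟨ *-identityˡ _ ⟨
    1# * share v x              ≤⟨ *-mono-≤ (inj₁ 0<1) (share-nonneg v 0≤x)
                                     (1≤fromℕ (1≤deg v)) ≤-refl ⟩
    fromℕ (deg v) * share v x   ≈⟨ deg*share v x ⟩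
    β * x                       ≤⟨ *-mono-≤ 0≤β 0≤x β≤1 ≤-refl ⟩
    1# * x                      ≈⟨ *-identityˡ x ⟩
    x                           ∎

  -- One specification for the three branches of `activate`. `entered` records the excess over the
  -- threshold at the moment of appending, since the residue may be cleared afterwards.
  record Activated (u : Fin n) (σ τ : State) : Set where
    field
      same-residue : ∀ w → residue τ w ≡ residue σ w
      appended     : ∃[ us ] queue τ ≡ queue σ ++ us
      unique       : Unique (queue σ) → Unique (queue τ)
      others       : ∀ {w} → w ≢ u → w ∈ queue τ → w ∈ queue σ
      entered      : u ∈ queue τ → u ∈ queue σ ⊎ θ u < residue σ u
      idle         : u ∉ queue τ → residue σ u ≤ θ u
      time         : clock τ ℕ.≤ clock σ ℕ.+ activateCost

  activate-spec : ∀ u σ → Activated u σ (activate u σ)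
  activate-spec u σ with fromℕ (deg u) * rmax <? residue σ u
  ... | no  θ≮r = record
    { same-residue = λ w → ≡.refl
    ; appended = [] , ≡.sym (List.++-identityʳ _)
    ; unique   = id
    ; others   = λ _ → id
    ; entered  = inj₁
    ; idle     = λ _ → ≮⇒≥ θ≮r
    ; time     = ℕ.+-monoʳ-≤ (clock σ) (ℕ.m≤m+n _ _)
    }
  ... | yes θ<r with u ∈? queue σ
  ...   | yes u∈Q = record
    { same-residue = λ w → ≡.refl
    ; appended = [] , ≡.sym (List.++-identityʳ _)
    ; unique   = id
    ; others   = λ _ → id
    ; entered  = inj₁
    ; idle     = λ u∉Q → ⊥-elim (u∉Q u∈Q)
    ; time     = ℕ.≤-trans (ℕ.≤-reflexive (ℕ.+-assoc (clock σ) _ _))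
        (ℕ.+-monoʳ-≤ (clock σ)
          (ℕ.+-monoʳ-≤ (arithmetic ℕ.+ comparison) (ℕ.m≤m+n _ _)))
    }
  ...   | no  u∉Q = record
    { same-residue = λ w → ≡.refl
    ; appended = [ u ] , ≡.refl
    ; unique   = λ uniq → Unique.++⁺ uniq ([] ∷ [])
        λ { (u∈Q , here ≡.refl) → u∉Q u∈Q }
    ; others   = λ w≢u w∈ → old w≢u (∈-++⁻ (queue σ) w∈)
    ; entered  = λ _ → inj₂ θ<r
    ; idle     = λ u∉ → ⊥-elim (u∉ (∈-++⁺ʳ (queue σ) (here ≡.refl)))
    ; time     = ℕ.≤-reflexive (≡.trans
        (ℕ.+-assoc (clock σ ℕ.+ (arithmetic ℕ.+ comparison)) _ _)
        (ℕ.+-assoc (clock σ) _ _))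
    }
    where
    old : ∀ {w} → w ≢ u → w ∈ queue σ ⊎ w ∈ [ u ] → w ∈ queue σ
    old w≢u (inj₁ w∈Q)         = w∈Q
    old w≢u (inj₂ (here w≡u))  = ⊥-elim (w≢u w≡u)

  -- Stated at a single node because it may fail, during a push, at the node being processed: that
  -- node has left the queue while its residue can still exceed the threshold. `residue≤` ensures
  -- that the credit covers what a push passes on.
  record Balanced (σ : State) (φ : Vector Carrier n) (w : Fin n) : Set where
    field
      nonneg   : 0# ≤ residue σ w
      residue≤ : residue σ w ≤ φ w
      queued   : w ∈ queue σ → ε * θ w ≤ φ w
      settled  : w ∉ queue σ → φ w ≈ residue σ w × residue σ w ≤ θ w

    credit-nonneg : 0# ≤ φ w
    credit-nonneg = ≤-trans nonneg residue≤

  Balanced-resp : ∀ {σ τ φ ψ w} → residue τ w ≡ residue σ w → ψ w ≡ φ w →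
                  (w ∈ queue τ → w ∈ queue σ) → (w ∈ queue σ → w ∈ queue τ) →
                  Balanced σ φ w → Balanced τ ψ w
  Balanced-resp {σ} {τ} {φ} {ψ} {w} r≡ φ≡ τ⊆σ σ⊆τ bal = record
    { nonneg   = ≡.subst (0# ≤_) (≡.sym r≡) nonneg
    ; residue≤ = ≡.subst₂ _≤_ (≡.sym r≡) (≡.sym φ≡) residue≤
    ; queued   = λ w∈ → ≡.subst (ε * θ w ≤_) (≡.sym φ≡) (queued (τ⊆σ w∈))
    ; settled  = λ w∉ → ≡.subst₂ (λ r f → f ≈ r × r ≤ θ w)
        (≡.sym r≡) (≡.sym φ≡) (settled (w∉ ∘ σ⊆τ))
    }
    where open Balanced bal

  appended-⊆ : ∀ {xs ys : List (Fin n)} → (∃[ us ] ys ≡ xs ++ us) →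
               ∀ {w} → w ∈ xs → w ∈ ys
  appended-⊆ (us , ≡.refl) = ∈-++⁺ˡ

  appended-trans : ∀ {xs ys zs : List (Fin n)} → (∃[ us ] ys ≡ xs ++ us) →
                   (∃[ us ] zs ≡ ys ++ us) → ∃[ us ] zs ≡ xs ++ us
  appended-trans {xs} (us , ≡.refl) (vs , ≡.refl) =
    us ++ vs , List.++-assoc xs us vs

  module Relax (v u : Fin n) (σ : State) where
    c : Carrier
    c = share v (residue σ v)

    σ⁺ : State
    σ⁺ = tick (4 ℕ.* arithmetic ℕ.+ assignment)
              record σ { residue = updateAt (residue σ) u (_+ c) }

    activated : Activated u σ⁺ (relax v σ u)
    activated = activate-spec u σ⁺
    open Activated activated public
      using (appended; unique; others; entered; idle)

    residue-other : ∀ {w} → w ≢ u → residue (relax v σ u) w ≡ residue σ w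
    residue-other {w} w≢u = ≡.trans (Activated.same-residue activated w)
                                    (updateAt-minimal w u (residue σ) w≢u)

    residue⁺ : residue σ⁺ u ≡ residue σ u + c
    residue⁺ = updateAt-updates u (residue σ)

    residue-target : residue (relax v σ u) u ≡ residue σ u + c
    residue-target = ≡.trans (Activated.same-residue activated u) residue⁺

    time : clock (relax v σ u) ℕ.≤ clock σ ℕ.+ relaxCost
    time = ℕ.≤-trans (Activated.time activated)
                     (ℕ.≤-reflexive (ℕ.+-assoc (clock σ) _ _))

    balanced-other : ∀ {φ ψ w} → w ≢ u → ψ w ≡ φ w →
                     Balanced σ φ w → Balanced (relax v σ u) ψ w
    balanced-other w≢u ψ≡φ =
      Balanced-resp (residue-other w≢u) ψ≡φ (others w≢u) (appended-⊆ appended)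

    balanced-target : ∀ {φ} → 0# ≤ c → Balanced σ φ u →
                      Balanced (relax v σ u) (updateAt φ u (_+ c)) u
    balanced-target {φ} 0≤c bal = record
      { nonneg   = ≡.subst (0# ≤_) (≡.sym residue-target) (+-nonneg nonneg 0≤c)
      ; residue≤ = ≡.subst₂ _≤_ (≡.sym residue-target) (≡.sym φ⁺) r+c≤φ+c
      ; queued   = λ u∈ → ≡.subst (ε * θ u ≤_) (≡.sym φ⁺) (enough (entered u∈))
      ; settled  = λ u∉ → ≡.subst₂ (λ r f → f ≈ r × r ≤ θ u)
          (≡.sym residue-target) (≡.sym φ⁺)
          ( +-congʳ (proj₁ (settled (u∉ ∘ appended-⊆ appended)))
          , ≡.subst (_≤ θ u) residue⁺ (idle u∉))
      }
      where
      open Balanced bal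
      φ⁺ : updateAt φ u (_+ c) u ≡ φ u + c
      φ⁺ = updateAt-updates u φ

      r+c≤φ+c : residue σ u + c ≤ φ u + c
      r+c≤φ+c = +-mono-≤ residue≤ ≤-refl

      enough : u ∈ queue σ ⊎ θ u < residue σ⁺ u → ε * θ u ≤ φ u + c
      enough (inj₁ u∈Q)  = ≤-trans (queued u∈Q) (x≤x+y 0≤c)
      enough (inj₂ θ<r) = ≤-trans (εθ≤θ u)
        (≤-trans (inj₁ (≡.subst (θ u <_) residue⁺ θ<r)) r+c≤φ+c)

  -- Scanning the out-neighbours of a node

  record Scanned (v : Fin n) (k : ℕ) (σ τ : State)
                 (φ ψ : Vector Carrier n) : Set where
    field
      appended    : ∃[ us ] queue τ ≡ queue σ ++ us
      unique      : Unique (queue τ)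
      balanced    : ∀ {w} → w ≢ v → Balanced τ ψ w
      own-residue : residue τ v ≡ residue σ v
      own-queue   : v ∈ queue τ → v ∈ queue σ
      own-credit  : ψ v ≡ φ v
      grows       : ∀ w → φ w ≤ ψ w
      total       : Σ ψ ≈ Σ φ + fromℕ k * share v (residue σ v)
      time        : clock τ ℕ.≤ clock σ ℕ.+ k ℕ.* relaxCost

  -- Because v ∉ us, the residue of v stays fixed, so every target receives the same share and
  -- `total` is an equation.
  scan : ∀ v us σ φ → v ∉ us → 0# ≤ residue σ v → Unique (queue σ) →
         (∀ {w} → w ≢ v → Balanced σ φ w) →
         ∃[ ψ ] Scanned v (length us) σ (foldl (relax v) σ us) φ ψ
  scan v [] σ φ v∉ 0≤r uniq bal = φ , record
    { appended    = [] , ≡.sym (List.++-identityʳ _)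
    ; unique      = uniq
    ; balanced    = bal
    ; own-residue = ≡.refl
    ; own-queue   = id
    ; own-credit  = ≡.refl
    ; grows       = λ w → ≤-refl
    ; total       = sym (trans (+-congˡ (zeroˡ _)) (+-identityʳ _))
    ; time        = ℕ.m≤m+n _ _
    }
  scan v (u ∷ us) σ φ v∉ 0≤r uniq bal = ψ , record
    { appended    = appended-trans R.appended S.appended
    ; unique      = S.unique
    ; balanced    = S.balanced
    ; own-residue = ≡.trans S.own-residue own
    ; own-queue   = R.others v≢u ∘ S.own-queue
    ; own-credit  = ≡.trans S.own-credit (updateAt-minimal v u φ v≢u)
    ; grows       = λ w → ≤-trans (φ≤φ₁ w) (S.grows w)
    ; total       = total
    ; time        = ℕ.≤-trans S.time (ℕ.≤-trans
        (ℕ.+-monoˡ-≤ (length us ℕ.* relaxCost) R.time)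
        (ℕ.≤-reflexive (ℕ.+-assoc (clock σ) relaxCost _)))
    }
    where
    module R = Relax v u σ

    v≢u : v ≢ u
    v≢u = v∉ ∘ here

    φ₁ : Vector Carrier n
    φ₁ = updateAt φ u (_+ R.c)

    own : residue (relax v σ u) v ≡ residue σ v
    own = R.residue-other v≢u

    0≤c : 0# ≤ R.c
    0≤c = share-nonneg v 0≤r

    φ≤φ₁ : ∀ w → φ w ≤ φ₁ w
    φ≤φ₁ w with w Fin.≟ u
    ... | yes ≡.refl = ≤-trans (x≤x+y 0≤c)
                               (inj₂ (reflexive (≡.sym (updateAt-updates u φ))))
    ... | no  w≢u    = inj₂ (reflexive (≡.sym (updateAt-minimal w u φ w≢u)))

    bal₁ : ∀ {w} → w ≢ v → Balanced (relax v σ u) φ₁ w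
    bal₁ {w} w≢v with w Fin.≟ u
    ... | yes ≡.refl = R.balanced-target 0≤c (bal w≢v)
    ... | no  w≢u    = R.balanced-other w≢u (updateAt-minimal w u φ w≢u) (bal w≢v)

    rest : ∃[ ψ ] Scanned v (length us) (relax v σ u) _ φ₁ ψ
    rest = scan v us (relax v σ u) φ₁ (v∉ ∘ there)
      (≡.subst (0# ≤_) (≡.sym own) 0≤r) (R.unique uniq) bal₁

    ψ : Vector Carrier n
    ψ = proj₁ rest

    module S = Scanned (proj₂ rest)

    φ₁-total : Σ φ₁ ≈ Σ φ + R.c
    φ₁-total = +-cancelʳ (φ u) _ _ (begin-equality
      Σ φ₁ + φ u        ≈⟨ Σ-updateAt φ u (_+ R.c) ⟩
      Σ φ + (φ u + R.c) ≈⟨ solve 3 (λ a b c → a :+ (b :+ c) := a :+ c :+ b) refl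
                             (Σ φ) (φ u) R.c ⟩
      Σ φ + R.c + φ u   ∎)

    total : Σ ψ ≈ Σ φ + fromℕ (length (u ∷ us)) * R.c
    total = begin-equality
      Σ ψ
        ≈⟨ S.total ⟩
      Σ φ₁ + fromℕ (length us) * share v (residue (relax v σ u) v)
        ≈⟨ +-cong φ₁-total (*-congˡ (reflexive (≡.cong (share v) own))) ⟩
      Σ φ + R.c + fromℕ (length us) * R.c
        ≈⟨ +-assoc _ _ _ ⟩
      Σ φ + (R.c + fromℕ (length us) * R.c)
        ≈⟨ +-congˡ (+-congʳ (*-identityˡ R.c)) ⟨
      Σ φ + (1# * R.c + fromℕ (length us) * R.c)
        ≈⟨ +-congˡ (distribʳ R.c 1# _) ⟨
      Σ φ + fromℕ (length (u ∷ us)) * R.c ∎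

  record Swept (v : Fin n) (σ τ : State) (φ ψ : Vector Carrier n) : Set where
    field
      appended   : ∃[ us ] queue τ ≡ queue σ ++ us
      unique     : Unique (queue τ)
      balanced   : ∀ {w} → w ≢ v → Balanced τ ψ w
      own-queue  : v ∈ queue τ → θ v ≤ residue σ v + residue σ v
      own-credit : ψ v ≡ φ v
      grows      : ∀ w → φ w ≤ ψ w
      total      : Σ ψ ≤ Σ φ + β * residue σ v
      time       : clock τ ℕ.≤ clock σ ℕ.+ deg v ℕ.* relaxCost

  Unique-middle : ∀ {v : Fin n} us {ws} → Unique (us ++ v ∷ ws) → v ∉ us × v ∉ ws
  Unique-middle []       uniq          = (λ ()) , Unique.Unique[x∷xs]⇒x∉xs uniq
  Unique-middle (u ∷ us) uniq@(_ ∷ uniq′) =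
    (λ { (here ≡.refl) → Unique.Unique[x∷xs]⇒x∉xs uniq (∈-++⁺ʳ us (here ≡.refl))
       ; (there v∈us)  → proj₁ (Unique-middle us uniq′) v∈us }) ,
    proj₂ (Unique-middle us uniq′)

  -- After the self-loop the neighbours of v receive the larger share c₁, but
  -- only deg v - 1 of them remain, and c₁ pays for the loss: deg v * c₁ =
  -- β (x + c₀) and β c₀ ≤ c₁.
  self-loop-shares : ∀ v {x} → 0# ≤ x → ∀ j k → deg v ≡ j ℕ.+ suc k →
    let c₀ = share v x in
    fromℕ j * c₀ + fromℕ k * share v (x + c₀) ≤ β * x
  self-loop-shares v {x} 0≤x j k deg≡ =
    ≤-from (+-mono-≤ (*-monoʳ-≤ (fromℕ-nonneg j) c₀≤c₁) βc₀≤c₁) (begin-equality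
      J * c₀ + K * c₁ + (J * c₁ + c₁)
        ≈⟨ solve 4 (λ J K a b → J :* a :+ K :* b :+ (J :* b :+ b) :=
                                J :* a :+ (J :* b :+ (b :+ K :* b))) refl J K c₀ c₁ ⟩
      J * c₀ + (J * c₁ + (c₁ + K * c₁))
        ≈⟨ +-congˡ total ⟩
      J * c₀ + (β * x + β * c₀)
        ≈⟨ solve 3 (λ a b c → a :+ (b :+ c) := b :+ (a :+ c)) refl
             (J * c₀) (β * x) (β * c₀) ⟩
      β * x + (J * c₀ + β * c₀) ∎)
    where
    J K c₀ c₁ : Carrier
    J  = fromℕ j
    K  = fromℕ k
    c₀ = share v x
    c₁ = share v (x + c₀)

    0≤c₀ : 0# ≤ c₀
    0≤c₀ = share-nonneg v 0≤x

    c₀≤c₁ : c₀ ≤ c₁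
    c₀≤c₁ = share-mono v (x≤x+y 0≤c₀)

    βc₀≤c₁ : β * c₀ ≤ c₁
    βc₀≤c₁ = ≤-trans (*-mono-≤ 0≤β 0≤c₀ β≤1 ≤-refl)
                     (≤-trans (inj₂ (*-identityˡ c₀)) c₀≤c₁)

    total : J * c₁ + (c₁ + K * c₁) ≈ β * x + β * c₀
    total = begin-equality
      J * c₁ + (c₁ + K * c₁)       ≈⟨ +-congˡ (+-congʳ (*-identityˡ c₁)) ⟨
      J * c₁ + (1# * c₁ + K * c₁)  ≈⟨ solve 4 (λ J K i c → J :* c :+ (i :* c :+ K :* c) :=
                                        (J :+ (i :+ K)) :* c) refl J K 1# c₁ ⟩
      (J + fromℕ (suc k)) * c₁     ≈⟨ *-congʳ (fromℕ-+ j (suc k)) ⟨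
      fromℕ (j ℕ.+ suc k) * c₁     ≡⟨ ≡.cong (λ i → fromℕ i * c₁) deg≡ ⟨
      fromℕ (deg v) * c₁           ≈⟨ deg*share v (x + c₀) ⟩
      β * (x + c₀)                 ≈⟨ distribˡ β x c₀ ⟩
      β * x + β * c₀               ∎

  -- A self-loop raises the residue of v in mid-scan, so later neighbours get a larger share.
  -- `out v` is therefore cut at v; uniqueness keeps v out of both pieces, and `scan` treats each of
  -- them with its own constant share.
  sweep : ∀ v σ φ → v ∉ queue σ → Unique (queue σ) →
          (∀ {w} → w ≢ v → Balanced σ φ w) → 0# ≤ residue σ v →
          ∃[ ψ ] Swept v σ (foldl (relax v) σ (out v)) φ ψ
  sweep v σ φ v∉Q uniq bal 0≤r with v ∈? out v
  ... | no v∉out = proj₁ scanned , record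
    { appended   = S.appended
    ; unique     = S.unique
    ; balanced   = S.balanced
    ; own-queue  = λ v∈ → ⊥-elim (v∉Q (S.own-queue v∈))
    ; own-credit = S.own-credit
    ; grows      = S.grows
    ; total      = inj₂ (trans S.total (+-congˡ (deg*share v (residue σ v))))
    ; time       = S.time
    }
    where
    scanned : ∃[ ψ ] Scanned v (deg v) σ _ φ ψ
    scanned = scan v (out v) σ φ v∉out 0≤r uniq bal
    module S = Scanned (proj₂ scanned)
  ... | yes v∈out with ∈-∃++ v∈out
  ...   | us , ws , out≡ = ψ ,
    ≡.subst (λ τ → Swept v σ τ φ ψ)
      (≡.trans (≡.sym (List.foldl-++ (relax v) σ us (v ∷ ws)))
               (≡.cong (foldl (relax v) σ) (≡.sym out≡)))
      (record
        { appended   = appended-trans S₁.appended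
                         (appended-trans R.appended S₂.appended)
        ; unique     = S₂.unique
        ; balanced   = S₂.balanced
        ; own-queue  = λ v∈ → own-queue (R.entered (S₂.own-queue v∈))
        ; own-credit = ≡.trans S₂.own-credit S₁.own-credit
        ; grows      = λ w → ≤-trans (S₁.grows w) (S₂.grows w)
        ; total      = total
        ; time       = time
        })
    where
    r : Carrier
    r = residue σ v

    v∉ : v ∉ us × v ∉ ws
    v∉ = Unique-middle us (≡.subst Unique out≡ (out-unique v))

    first : ∃[ χ ] Scanned v (length us) σ (foldl (relax v) σ us) φ χ
    first = scan v us σ φ (proj₁ v∉) 0≤r uniq bal

    module S₁ = Scanned (proj₂ first)
    module R = Relax v v (foldl (relax v) σ us)

    σ₂ : State
    σ₂ = relax v (foldl (relax v) σ us) v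

    r₂≡ : residue σ₂ v ≡ r + share v r
    r₂≡ = ≡.trans R.residue-target
                  (≡.cong (λ x → x + share v x) S₁.own-residue)

    0≤r₂ : 0# ≤ residue σ₂ v
    0≤r₂ = ≡.subst (0# ≤_) (≡.sym r₂≡) (+-nonneg 0≤r (share-nonneg v 0≤r))

    -- The credit passes the self-loop unchanged: what v sends to itself will be erased by `clear`,
    -- so it is never entered as credit.
    second : ∃[ ψ ] Scanned v (length ws) σ₂ _ (proj₁ first) ψ
    second = scan v ws σ₂ (proj₁ first) (proj₂ v∉) 0≤r₂ (R.unique S₁.unique)
      λ w≢v → R.balanced-other w≢v ≡.refl (S₁.balanced w≢v)

    module S₂ = Scanned (proj₂ second)

    ψ : Vector Carrier n
    ψ = proj₁ second

    own-queue : v ∈ queue (foldl (relax v) σ us) ⊎ θ v < residue R.σ⁺ v →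
                θ v ≤ r + r
    own-queue (inj₁ v∈)  = ⊥-elim (v∉Q (S₁.own-queue v∈))
    own-queue (inj₂ θ<r) = begin
      θ v           ≤⟨ inj₁ θ<r ⟩
      residue R.σ⁺ v ≡⟨ R.residue⁺ ⟩
      residue (foldl (relax v) σ us) v + R.c
                    ≡⟨ ≡.cong (λ x → x + share v x) S₁.own-residue ⟩
      -- The append saw r plus the self-loop share; since a share never exceeds the residue, the
      -- threshold is at most 2 r.
      r + share v r ≤⟨ +-mono-≤ ≤-refl (share≤ v 0≤r) ⟩
      r + r         ∎

    deg≡ : deg v ≡ length us ℕ.+ suc (length ws)
    deg≡ = ≡.trans (≡.cong length out≡) (List.length-++ us)

    total : Σ ψ ≤ Σ φ + β * r
    total = begin
      Σ ψ
        ≈⟨ S₂.total ⟩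
      Σ (proj₁ first) + fromℕ (length ws) * share v (residue σ₂ v)
        ≈⟨ +-cong S₁.total (*-congˡ (reflexive (≡.cong (share v) r₂≡))) ⟩
      Σ φ + fromℕ (length us) * share v r + fromℕ (length ws) * share v (r + share v r)
        ≈⟨ +-assoc _ _ _ ⟩
      Σ φ + (fromℕ (length us) * share v r + fromℕ (length ws) * share v (r + share v r))
        ≤⟨ +-mono-≤ ≤-refl (self-loop-shares v 0≤r (length us) (length ws) deg≡) ⟩
      Σ φ + β * r ∎

    time : clock (foldl (relax v) σ₂ ws) ℕ.≤ clock σ ℕ.+ deg v ℕ.* relaxCost
    time = ℕR.begin
      clock (foldl (relax v) σ₂ ws)
        ℕR.≤⟨ S₂.time ⟩
      clock σ₂ ℕ.+ k ℕ.* relaxCost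
        ℕR.≤⟨ ℕ.+-monoˡ-≤ _ (ℕ.≤-trans R.time (ℕ.+-monoˡ-≤ relaxCost S₁.time)) ⟩
      clock σ ℕ.+ j ℕ.* relaxCost ℕ.+ relaxCost ℕ.+ k ℕ.* relaxCost
        ℕR.≡⟨ ℕS.solve 4 (λ t a b c → t ℕS.:+ a ℕS.:* c ℕS.:+ c ℕS.:+ b ℕS.:* c ℕS.:=
                t ℕS.:+ (a ℕS.:+ (ℕS.con 1 ℕS.:+ b)) ℕS.:* c) ≡.refl
                (clock σ) j k relaxCost ⟩
      clock σ ℕ.+ (j ℕ.+ suc k) ℕ.* relaxCost
        ℕR.≡⟨ ≡.cong (λ d → clock σ ℕ.+ d ℕ.* relaxCost) deg≡ ⟨
      clock σ ℕ.+ deg v ℕ.* relaxCost ℕR.∎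
      where
      j k : ℕ
      j = length us
      k = length ws

  -- The net effect of one push

  record Pushed (v : Fin n) (σ τ : State) (φ ψ : Vector Carrier n) : Set where
    field
      appended : ∃[ us ] queue τ ≡ queue σ ++ us
      unique   : Unique (queue τ)
      balanced : ∀ w → Balanced τ ψ w
      grows    : ∀ {w} → w ≢ v → φ w ≤ ψ w
      drop     : Σ ψ + ε * φ v ≤ Σ φ
      time     : clock τ ℕ.≤ clock σ ℕ.+ pushCost ℕ.* deg v

  push-spec : ∀ v σ φ → v ∉ queue σ → Unique (queue σ) →
              (∀ {w} → w ≢ v → Balanced σ φ w) →
              0# ≤ residue σ v → residue σ v ≤ φ v →
              ∃[ ψ ] Pushed v σ (push v σ) φ ψ
  push-spec v σ φ v∉Q uniq bal 0≤r r≤φ = ψ , record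
    { appended = S.appended
    ; unique   = S.unique
    ; balanced = balanced
    ; grows    = grows
    ; drop     = drop
    ; time     = time
    }
    where
    r : Carrier
    r = residue σ v

    -- The popped node gives up its whole credit before the sweep; δ below is what it gets back.
    φ₀ : Vector Carrier n
    φ₀ = updateAt φ v (const 0#)

    swept : ∃[ χ ] Swept v (gain v σ) (foldl (relax v) (gain v σ) (out v)) φ₀ χ
    swept = sweep v (gain v σ) φ₀ v∉Q uniq
      (λ w≢v → Balanced-resp ≡.refl (updateAt-minimal _ v φ w≢v) id id (bal w≢v)) 0≤r

    module S = Swept (proj₂ swept)

    χ : Vector Carrier n
    χ = proj₁ swept

    τ₀ : State
    τ₀ = foldl (relax v) (gain v σ) (out v)

    -- ε θ(v) if v re-appended itself, otherwise 0, which then equals its cleared residue.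
    credit : ∃[ δ ] (0# ≤ δ × δ ≤ ε * (r + r) ×
      (v ∈ queue τ₀ → ε * θ v ≤ δ) × (v ∉ queue τ₀ → δ ≈ 0#))
    credit with v ∈? queue τ₀
    ... | yes v∈ = ε * θ v , *-nonneg 0≤ε (0≤θ v) ,
      *-monoʳ-≤ 0≤ε (S.own-queue v∈) , (λ _ → ≤-refl) , (λ v∉ → ⊥-elim (v∉ v∈))
    ... | no  v∉ = 0# , ≤-refl , *-nonneg 0≤ε (+-nonneg 0≤r 0≤r) ,
      (λ v∈ → ⊥-elim (v∉ v∈)) , (λ _ → refl)

    δ : Carrier
    δ = proj₁ credit

    ψ : Vector Carrier n
    ψ = updateAt χ v (const δ)

    ψ-own : ψ v ≡ δ
    ψ-own = updateAt-updates v χ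

    ψ-other : ∀ {w} → w ≢ v → ψ w ≡ χ w
    ψ-other {w} = updateAt-minimal w v χ

    balanced : ∀ w → Balanced (push v σ) ψ w
    balanced w with w Fin.≟ v
    ... | no w≢v = Balanced-resp (updateAt-minimal w v (residue τ₀) w≢v)
                     (ψ-other w≢v) id id (S.balanced w≢v)
    ... | yes ≡.refl = record
      { nonneg   = inj₂ (reflexive (≡.sym cleared))
      ; residue≤ = ≡.subst₂ _≤_ (≡.sym cleared) (≡.sym ψ-own) (proj₁ (proj₂ credit))
      ; queued   = λ v∈ → ≡.subst (ε * θ v ≤_) (≡.sym ψ-own)
          (proj₁ (proj₂ (proj₂ (proj₂ credit))) v∈)
      ; settled  = λ v∉ →
          ≡.subst₂ (λ x y → y ≈ x × x ≤ θ v) (≡.sym cleared) (≡.sym ψ-own)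
            (proj₂ (proj₂ (proj₂ (proj₂ credit))) v∉ , 0≤θ v)
      }
      where
      cleared : residue (push v σ) v ≡ 0#
      cleared = updateAt-updates v (residue τ₀)

    grows : ∀ {w} → w ≢ v → φ w ≤ ψ w
    grows {w} w≢v = begin
      φ w  ≡⟨ updateAt-minimal w v φ w≢v ⟨
      φ₀ w ≤⟨ S.grows w ⟩
      χ w  ≡⟨ ψ-other w≢v ⟨
      ψ w  ∎

    χ-own : χ v ≡ 0#
    χ-own = ≡.trans S.own-credit (updateAt-updates v φ)

    drop : Σ ψ + ε * φ v ≤ Σ φ
    drop = begin
      Σ ψ + ε * φ v
        ≈⟨ +-congʳ (trans (sym (+-identityʳ _)) (trans (+-congˡ (reflexive (≡.sym χ-own)))
             (Σ-updateAt χ v (const δ)))) ⟩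
      Σ χ + δ + ε * φ v
        ≤⟨ +-mono-≤ (+-mono-≤ S.total (proj₁ (proj₂ (proj₂ credit)))) ≤-refl ⟩
      Σ φ₀ + β * r + ε * (r + r) + ε * φ v
        ≈⟨ solve 5 (λ a b e r f → a :+ b :* r :+ e :* (r :+ r) :+ e :* f :=
             a :+ ((b :+ (e :+ e)) :* r :+ e :* f)) refl (Σ φ₀) β ε r (φ v) ⟩
      Σ φ₀ + ((β + (ε + ε)) * r + ε * φ v)
        -- The residue is replaced by the credit, which may be larger; β and the three parts ε then
        -- use up φ(v) exactly.
        ≤⟨ +-mono-≤ ≤-refl (+-mono-≤
             (*-monoʳ-≤ (+-nonneg 0≤β (+-nonneg 0≤ε 0≤ε)) r≤φ) ≤-refl) ⟩
      Σ φ₀ + ((β + (ε + ε)) * φ v + ε * φ v)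
        ≈⟨ solve 4 (λ a b e f → a :+ ((b :+ (e :+ e)) :* f :+ e :* f) :=
             a :+ (b :+ (e :+ e :+ e)) :* f) refl (Σ φ₀) β ε (φ v) ⟩
      Σ φ₀ + (β + (ε + ε + ε)) * φ v
        ≈⟨ +-congˡ (trans (*-congʳ β+3ε≈1) (*-identityˡ (φ v))) ⟩
      Σ φ₀ + φ v
        ≈⟨ Σ-updateAt φ v (const 0#) ⟩
      Σ φ + 0#
        ≈⟨ +-identityʳ _ ⟩
      Σ φ ∎

    time : clock (push v σ) ℕ.≤ clock σ ℕ.+ pushCost ℕ.* deg v
    time = ℕR.begin
      clock τ₀ ℕ.+ assignment
        ℕR.≤⟨ ℕ.+-monoˡ-≤ assignment S.time ⟩
      clock σ ℕ.+ a ℕ.+ deg v ℕ.* relaxCost ℕ.+ assignment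
        ℕR.≡⟨ ℕS.solve 4 (λ t a b c → t ℕS.:+ a ℕS.:+ b ℕS.:+ c ℕS.:=
                t ℕS.:+ ((a ℕS.:+ c) ℕS.:+ b)) ≡.refl
                (clock σ) a (deg v ℕ.* relaxCost) assignment ⟩
      clock σ ℕ.+ ((a ℕ.+ assignment) ℕ.+ deg v ℕ.* relaxCost)
        ℕR.≤⟨ ℕ.+-monoʳ-≤ (clock σ) (ℕ.+-mono-≤
                (ℕ.m≤m*n (a ℕ.+ assignment) (deg v) {{ℕ.>-nonZero (1≤deg v)}})
                (ℕ.≤-reflexive (ℕ.*-comm (deg v) relaxCost))) ⟩
      clock σ ℕ.+ ((a ℕ.+ assignment) ℕ.* deg v ℕ.+ relaxCost ℕ.* deg v)
        ℕR.≡⟨ ≡.cong (clock σ ℕ.+_) (ℕ.*-distribʳ-+ (deg v) (a ℕ.+ assignment) relaxCost) ⟨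
      clock σ ℕ.+ pushCost ℕ.* deg v ℕR.∎
      where
      a : ℕ
      a = 2 ℕ.* arithmetic ℕ.+ assignment

  -- Rounds, phases and the budget

  m lam : Carrier
  m   = fromℕ edges
  lam = m * rmax

  degree : Vector Carrier n
  degree w = fromℕ (deg w)

  0≤m : 0# ≤ m
  0≤m = fromℕ-nonneg edges

  Σ-degree : Σ degree ≈ m
  Σ-degree = Σ-fromℕ deg

  Σ-θ : Σ θ ≈ lam
  Σ-θ = begin-equality
    Σ θ                      ≈⟨ Σ-cong (λ w → *-comm (degree w) rmax) ⟩
    Σ (λ w → rmax * degree w) ≈⟨ Σ-*ˡ rmax degree ⟩
    rmax * Σ degree          ≈⟨ *-comm _ _ ⟩
    Σ degree * rmax          ≈⟨ *-congʳ Σ-degree ⟩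
    lam ∎

  credit≤θ : ∀ {σ φ w} → Balanced σ φ w → w ∉ queue σ → φ w ≤ θ w
  credit≤θ bal w∉ with Balanced.settled bal w∉
  ... | φ≈r , r≤θ = ≤-trans (inj₂ φ≈r) r≤θ

  -- The potential replacing log: in the k-th phase the credit is valued at
  -- u = 2 ^ k per unit, and each of the j remaining phases at one unit.  All
  -- values are multiplied by m.
  Budget : Carrier → ℕ → Carrier → ℕ → Carrier → Set
  Budget B T u j Φ = ε * ε * fromℕ T + (u * Φ + fromℕ j) * m ≤ B

  module Execution (base : ℕ) (B : Carrier) where

    -- T is the total degree pushed in completed rounds. Each doubling of u spends one phase and so
    -- preserves `scale`; once j = 0 it reads 1 ≤ u λ, and the bound in terms of λ takes over.
    record Between (σ : State) (φ : Vector Carrier n) : Set where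
      field
        balanced : ∀ w → Balanced σ φ w
        unique   : Unique (queue σ)
        T        : ℕ
        u        : Carrier
        j        : ℕ
        0<u      : 0# < u
        scale    : 1# ≤ u * fromℕ (2 ℕ.^ j) * lam
        budget   : Budget B T u j (Σ φ)
        time     : clock σ ℕ.≤ base ℕ.+ stepCost ℕ.* T

    -- front lists the nodes of the queue still to be pushed in the current
    -- round; Y and X are the sums of the degrees and of the credits (when
    -- pushed) of the nodes already pushed in it, and Φ is the total credit at
    -- its start.
    record Round (σ : State) (φ : Vector Carrier n) (front : List (Fin n)) : Set where
      field
        back     : List (Fin n)
        queue≡   : queue σ ≡ front ++ back
        balanced : ∀ w → Balanced σ φ w
        unique   : Unique (queue σ)
        T Y      : ℕ
        X Φ u    : Carrier
        j        : ℕ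
        0<u      : 0# < u
        scale    : 1# ≤ u * fromℕ (2 ℕ.^ j) * lam
        budget   : Budget B T u j Φ
        large    : 1# ≤ u * Φ ⊎ 1# ≤ u * lam
        distinct : fromℕ Y + Σ[ front ] degree ≤ m
        covered  : Φ + (rmax * fromℕ Y + Σ[ front ] θ) ≤ X + Σ[ front ] φ + lam
        paid     : ε * rmax * fromℕ Y ≤ X
        drop     : Σ φ + ε * X ≤ Φ
        time     : clock σ ℕ.≤ base ℕ.+ stepCost ℕ.* (T ℕ.+ Y)

    fromℕ-2^suc : ∀ j → fromℕ (2 ℕ.^ suc j) ≈ fromℕ (2 ℕ.^ j) + fromℕ (2 ℕ.^ j)
    fromℕ-2^suc j = trans (fromℕ-+ (2 ℕ.^ j) _)
      (+-congˡ (reflexive (≡.cong fromℕ (ℕ.+-identityʳ (2 ℕ.^ j)))))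

    -- As long as u Φ < 1, doubling u raises the value of the credit by less than one unit, which
    -- the phase given up pays for. Several phases may be skipped at once.
    rescale : ∀ T Φ j u → 0# < u → 1# ≤ u * fromℕ (2 ℕ.^ j) * lam →
              Budget B T u j Φ →
              ∃[ j′ ] ∃[ u′ ] (0# < u′ × 1# ≤ u′ * fromℕ (2 ℕ.^ j′) * lam ×
                Budget B T u′ j′ Φ × (1# ≤ u′ * Φ ⊎ 1# ≤ u′ * lam))
    -- With no phase left, `scale` is 1 ≤ u λ because 2 ^ 0 = 1.
    rescale T Φ zero u 0<u scale budget = 0 , u , 0<u , scale , budget ,
      inj₂ (≤-trans scale (inj₂ (*-congʳ (trans (*-congˡ fromℕ-1) (*-identityʳ u)))))
    rescale T Φ (suc j) u 0<u scale budget with u * Φ <? 1#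
    ... | no  uΦ≮1 = suc j , u , 0<u , scale , budget , inj₁ (≮⇒≥ uΦ≮1)
    ... | yes uΦ<1 = rescale T Φ j (u + u) 0<2u scale′
      (≤-trans (+-mono-≤ ≤-refl cheaper) budget)
      where
      0<2u : 0# < u + u
      0<2u = <-≤-trans 0<u (x≤x+y (inj₁ 0<u))

      scale′ : 1# ≤ (u + u) * fromℕ (2 ℕ.^ j) * lam
      scale′ = ≤-trans scale (inj₂ (trans (*-congʳ (*-congˡ (fromℕ-2^suc j)))
        (solve 3 (λ u p l → u :* (p :+ p) :* l := (u :+ u) :* p :* l) refl
          u (fromℕ (2 ℕ.^ j)) lam)))

      cheaper : ((u + u) * Φ + fromℕ j) * m ≤ (u * Φ + fromℕ (suc j)) * m
      cheaper = begin
        ((u + u) * Φ + fromℕ j) * m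
          ≈⟨ solve 4 (λ u f j m → ((u :+ u) :* f :+ j) :* m :=
               m :* (u :* f :+ (u :* f :+ j))) refl u Φ (fromℕ j) m ⟩
        m * (u * Φ + (u * Φ + fromℕ j))
          ≤⟨ *-monoʳ-≤ 0≤m (+-mono-≤ ≤-refl (+-mono-≤ (inj₁ uΦ<1) ≤-refl)) ⟩
        m * (u * Φ + fromℕ (suc j))
          ≈⟨ *-comm _ _ ⟩
        (u * Φ + fromℕ (suc j)) * m ∎

    beginRound : ∀ {σ φ} → Between σ φ → Round σ φ (queue σ)
    beginRound {σ} {φ} between =
      let j′ , u′ , 0<u′ , scale′ , budget′ , large = rescale T (Σ φ) j u 0<u scale budget
      in record
        { back     = []
        ; queue≡   = ≡.sym (List.++-identityʳ _)
        ; balanced = balanced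
        ; unique   = unique
        ; T        = T
        ; Y        = 0
        ; X        = 0#
        ; Φ        = Σ φ
        ; u        = u′
        ; j        = j′
        ; 0<u      = 0<u′
        ; scale    = scale′
        ; budget   = budget′
        ; large    = large
        ; distinct = begin
            0# + Σ[ queue σ ] degree ≈⟨ +-identityˡ _ ⟩
            Σ[ queue σ ] degree      ≤⟨ Σ[]≤Σ unique degree (fromℕ-nonneg ∘ deg) ⟩
            Σ degree                 ≈⟨ Σ-degree ⟩
            m                        ∎
        ; covered  = begin
            Σ φ + (rmax * 0# + Σ[ queue σ ] θ)
              ≈⟨ +-congˡ (trans (+-congʳ (zeroʳ rmax)) (+-identityˡ _)) ⟩
            Σ φ + Σ[ queue σ ] θ
              -- Outside the queue the credit equals the residue, which is at most the threshold.
              ≤⟨ Σ-exchange unique φ θ (λ {w} → credit≤θ (balanced w)) ⟩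
            Σ[ queue σ ] φ + Σ θ
              ≈⟨ +-cong (sym (+-identityˡ _)) Σ-θ ⟩
            0# + Σ[ queue σ ] φ + lam ∎
        ; paid     = inj₂ (zeroʳ _)
        ; drop     = inj₂ (trans (+-congˡ (zeroʳ ε)) (+-identityʳ _))
        ; time     = ≡.subst (λ T → clock σ ℕ.≤ base ℕ.+ stepCost ℕ.* T)
            (≡.sym (ℕ.+-identityʳ T)) time
        }
      where open Between between

    -- With z = m - Y, the nodes outside the round hold credit at most z rmax,
    -- so ε Y Φ ≤ ε Y (X + z rmax) ≤ X (Y + z).
    round-gain : ∀ {y X Φ} → 0# ≤ y → y ≤ m → 0# ≤ X →
                 Φ + rmax * y ≤ X + lam → ε * rmax * y ≤ X → ε * Φ * y ≤ X * m
    round-gain {y} {X} {Φ} 0≤y y≤m 0≤X covered paid = begin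
      ε * Φ * y
        ≤⟨ ≤-from (*-monoʳ-≤ (*-nonneg 0≤ε 0≤y) covered) eq ⟩
      ε * (y * X) + z * (ε * rmax * y)
        ≤⟨ +-mono-≤ (*-mono-≤ 0≤ε (*-nonneg 0≤y 0≤X) ε≤1 ≤-refl)
                    (*-monoʳ-≤ 0≤z paid) ⟩
      1# * (y * X) + z * X
        ≈⟨ +-congʳ (*-identityˡ _) ⟩
      y * X + z * X
        ≈⟨ solve 3 (λ y z x → y :* x :+ z :* x := x :* (z :+ y)) refl y z X ⟩
      X * (z + y)
        ≈⟨ *-congˡ (cancel m y) ⟩
      X * m ∎
      where
      z : Carrier
      z = m - y

      0≤z : 0# ≤ z
      0≤z = ≤-from y≤m (trans (+-identityˡ m) (sym (cancel m y)))

      eq : ε * Φ * y + ε * y * (X + lam) ≈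
           ε * (y * X) + z * (ε * rmax * y) + ε * y * (Φ + rmax * y)
      eq = begin-equality
        ε * Φ * y + ε * y * (X + lam)
          ≈⟨ +-congˡ (*-congˡ (+-congˡ (*-congʳ (cancel m y)))) ⟨
        ε * Φ * y + ε * y * (X + (z + y) * rmax)
          ≈⟨ solve 6 (λ e f y x z r →
               e :* f :* y :+ e :* y :* (x :+ (z :+ y) :* r) :=
               e :* (y :* x) :+ z :* (e :* r :* y) :+ e :* y :* (f :+ r :* y))
               refl ε Φ y X z rmax ⟩
        ε * (y * X) + z * (ε * rmax * y) + ε * y * (Φ + rmax * y) ∎

    -- The round adds ε² Y to the first summand of the budget. The credit has fallen by at least ε
    -- X, which frees u ε X m; `large` tells which of the two lower bounds on X makes this enough.
    endRound : ∀ {σ φ} → Round σ φ [] → Between σ φ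
    endRound {σ} {φ} round = record
      { balanced = balanced
      ; unique   = unique
      ; T        = T ℕ.+ Y
      ; u        = u
      ; j        = j
      ; 0<u      = 0<u
      ; scale    = scale
      ; budget   = begin
          ε * ε * fromℕ (T ℕ.+ Y) + (u * Σ φ + fromℕ j) * m
            ≈⟨ +-congʳ (*-congˡ (fromℕ-+ T Y)) ⟩
          ε * ε * (fromℕ T + y) + (u * Σ φ + fromℕ j) * m
            ≈⟨ solve 4 (λ e t y q → e :* e :* (t :+ y) :+ q :=
                 e :* e :* t :+ (q :+ e :* e :* y)) refl ε (fromℕ T) y _ ⟩
          ε * ε * fromℕ T + ((u * Σ φ + fromℕ j) * m + ε * ε * y)
            ≤⟨ +-mono-≤ ≤-refl (+-mono-≤ ≤-refl gained) ⟩
          ε * ε * fromℕ T + ((u * Σ φ + fromℕ j) * m + u * ε * (X * m))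
            ≈⟨ solve 7 (λ q u p j m e x →
                 q :+ ((u :* p :+ j) :* m :+ u :* e :* (x :* m)) :=
                 q :+ m :* (u :* (p :+ e :* x) :+ j)) refl
                 _ u (Σ φ) (fromℕ j) m ε X ⟩
          ε * ε * fromℕ T + m * (u * (Σ φ + ε * X) + fromℕ j)
            ≤⟨ +-mono-≤ ≤-refl (*-monoʳ-≤ 0≤m
                 (+-mono-≤ (*-monoʳ-≤ (inj₁ 0<u) drop) ≤-refl)) ⟩
          ε * ε * fromℕ T + m * (u * Φ + fromℕ j)
            ≈⟨ +-congˡ (*-comm _ _) ⟩
          ε * ε * fromℕ T + (u * Φ + fromℕ j) * m
            ≤⟨ budget ⟩
          B ∎
      ; time     = time
      }
      where
      open Round round
      y : Carrier
      y = fromℕ Y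

      0≤y : 0# ≤ y
      0≤y = fromℕ-nonneg Y

      y≤m : y ≤ m
      y≤m = ≤-trans (inj₂ (sym (+-identityʳ y))) distinct

      0≤X : 0# ≤ X
      0≤X = ≤-trans (*-nonneg (*-nonneg 0≤ε (inj₁ 0<rmax)) 0≤y) paid

      covered′ : Φ + rmax * y ≤ X + lam
      covered′ = begin
        Φ + rmax * y        ≈⟨ +-congˡ (+-identityʳ _) ⟨
        Φ + (rmax * y + 0#) ≤⟨ covered ⟩
        X + 0# + lam        ≈⟨ +-congʳ (+-identityʳ X) ⟩
        X + lam             ∎

      -- One computation for both alternatives: x is Φ in the first and λ in the second.
      scaled : ∀ {x} → 1# ≤ u * x → ε * x * y ≤ X * m → ε * ε * y ≤ u * ε * (X * m)
      scaled {x} 1≤ux εxy≤Xm = begin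
        ε * ε * y             ≈⟨ *-identityˡ _ ⟨
        1# * (ε * ε * y)      ≤⟨ *-mono-≤ (inj₁ 0<1) (*-nonneg (*-nonneg 0≤ε 0≤ε) 0≤y)
                                   1≤ux ≤-refl ⟩
        u * x * (ε * ε * y)   ≈⟨ solve 4 (λ u x e y → u :* x :* (e :* e :* y) :=
                                   u :* e :* (e :* x :* y)) refl u x ε y ⟩
        u * ε * (ε * x * y)   ≤⟨ *-monoʳ-≤ (*-nonneg (inj₁ 0<u) 0≤ε) εxy≤Xm ⟩
        u * ε * (X * m)       ∎

      gained : ε * ε * y ≤ u * ε * (X * m)
      gained with large
      ... | inj₁ 1≤uΦ   = scaled 1≤uΦ (round-gain 0≤y y≤m 0≤X covered′ paid)
      ... | inj₂ 1≤ulam = scaled 1≤ulam (begin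
        ε * lam * y        ≈⟨ solve 4 (λ e m r y → e :* (m :* r) :* y :=
                                m :* (e :* r :* y)) refl ε m rmax y ⟩
        m * (ε * rmax * y) ≤⟨ *-monoʳ-≤ 0≤m paid ⟩
        m * X              ≈⟨ *-comm m X ⟩
        X * m              ∎)

    -- Single pushes within a round, and termination

    quantum : Carrier
    quantum = ε * (ε * rmax)

    popped : State → List (Fin n) → State
    popped σ q = tick (queueOp ℕ.+ queueOp) (record σ { queue = q })

    -- The head of `front` moves its degree to Y and its credit to X. Newly appended nodes go to
    -- `back` and wait for the next round.
    advance : ∀ {σ φ v front} (round : Round σ φ (v ∷ front)) →
              ∃[ ψ ] (Round (push v (popped σ (front ++ Round.back round))) ψ front ×
                      Σ ψ + quantum ≤ Σ φ)
    advance {σ} {φ} {v} {front} round = ψ , record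
      { back     = back ++ proj₁ P.appended
      ; queue≡   = ≡.trans (proj₂ P.appended) (List.++-assoc front back _)
      ; balanced = P.balanced
      ; unique   = P.unique
      ; T        = T
      ; Y        = Y ℕ.+ deg v
      ; X        = X + φ v
      ; Φ        = Φ
      ; u        = u
      ; j        = j
      ; 0<u      = 0<u
      ; scale    = scale
      ; budget   = budget
      ; large    = large
      ; distinct = begin
          fromℕ (Y ℕ.+ deg v) + Σ[ front ] degree        ≈⟨ +-congʳ (fromℕ-+ Y (deg v)) ⟩
          fromℕ Y + fromℕ (deg v) + Σ[ front ] degree    ≈⟨ +-assoc _ _ _ ⟩
          fromℕ Y + (fromℕ (deg v) + Σ[ front ] degree)  ≤⟨ distinct ⟩
          m ∎
      ; covered  = begin
          Φ + (rmax * fromℕ (Y ℕ.+ deg v) + Σ[ front ] θ)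
            ≈⟨ +-congˡ (+-congʳ (*-congˡ (fromℕ-+ Y (deg v)))) ⟩
          Φ + (rmax * (fromℕ Y + fromℕ (deg v)) + Σ[ front ] θ)
            ≈⟨ solve 5 (λ f r y d t → f :+ (r :* (y :+ d) :+ t) :=
                 f :+ (r :* y :+ (d :* r :+ t))) refl
                 Φ rmax (fromℕ Y) (fromℕ (deg v)) (Σ[ front ] θ) ⟩
          Φ + (rmax * fromℕ Y + (θ v + Σ[ front ] θ))
            ≤⟨ covered ⟩
          X + (φ v + Σ[ front ] φ) + lam
            ≈⟨ +-congʳ (+-assoc _ _ _) ⟨
          X + φ v + Σ[ front ] φ + lam
            -- Waiting nodes keep or gain credit while v is pushed; uniqueness of the queue excludes
            -- v from `front`.
            ≤⟨ +-mono-≤ (+-mono-≤ ≤-refl (Σ[]-mono front λ w∈ →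
                 P.grows λ { ≡.refl → v∉ (∈-++⁺ˡ w∈) })) ≤-refl ⟩
          X + φ v + Σ[ front ] ψ + lam ∎
      ; paid     = begin
          ε * rmax * fromℕ (Y ℕ.+ deg v)
            ≈⟨ *-congˡ (fromℕ-+ Y (deg v)) ⟩
          ε * rmax * (fromℕ Y + fromℕ (deg v))
            ≈⟨ solve 4 (λ e r y d → e :* r :* (y :+ d) := e :* r :* y :+ e :* (d :* r))
                 refl ε rmax (fromℕ Y) (fromℕ (deg v)) ⟩
          ε * rmax * fromℕ Y + ε * θ v
            ≤⟨ +-mono-≤ paid εθ≤φ ⟩
          X + φ v ∎
      ; drop     = begin
          Σ ψ + ε * (X + φ v)
            ≈⟨ solve 4 (λ p e x f → p :+ e :* (x :+ f) := p :+ e :* f :+ e :* x)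
                 refl (Σ ψ) ε X (φ v) ⟩
          Σ ψ + ε * φ v + ε * X
            ≤⟨ +-mono-≤ P.drop ≤-refl ⟩
          Σ φ + ε * X
            ≤⟨ drop ⟩
          Φ ∎
      ; time     = time′
      } , (begin
          -- Origin of `quantum`: the push removes at least ε φ(v), a queued node has credit at
          -- least ε θ(v), and θ(v) ≥ rmax because deg v ≥ 1.
          Σ ψ + quantum ≤⟨ +-mono-≤ ≤-refl (*-monoʳ-≤ 0≤ε (≤-trans εrmax≤εθ εθ≤φ)) ⟩
          Σ ψ + ε * φ v ≤⟨ P.drop ⟩
          Σ φ           ∎)
      where
      open Round round

      uniq : Unique (v ∷ front ++ back)
      uniq = ≡.subst Unique queue≡ unique

      v∉ : v ∉ front ++ back
      v∉ = Unique.Unique[x∷xs]⇒x∉xs uniq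

      σ₀ : State
      σ₀ = popped σ (front ++ back)

      balanced₀ : ∀ {w} → w ≢ v → Balanced σ₀ φ w
      balanced₀ {w} w≢v = Balanced-resp ≡.refl ≡.refl
        (λ w∈ → ≡.subst (w ∈_) (≡.sym queue≡) (there w∈))
        (λ w∈ → tail (≡.subst (w ∈_) queue≡ w∈)) (balanced w)
        where
        tail : w ∈ v ∷ front ++ back → w ∈ front ++ back
        tail (here w≡v)  = ⊥-elim (w≢v w≡v)
        tail (there w∈) = w∈

      pushed : ∃[ ψ ] Pushed v σ₀ (push v σ₀) φ ψ
      pushed = push-spec v σ₀ φ v∉ (AllPairs.tail uniq) balanced₀
        (Balanced.nonneg (balanced v)) (Balanced.residue≤ (balanced v))

      module P = Pushed (proj₂ pushed)

      ψ : Vector Carrier n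
      ψ = proj₁ pushed

      εθ≤φ : ε * θ v ≤ φ v
      εθ≤φ = Balanced.queued (balanced v) (≡.subst (v ∈_) (≡.sym queue≡) (here ≡.refl))

      εrmax≤εθ : ε * rmax ≤ ε * θ v
      εrmax≤εθ = *-monoʳ-≤ 0≤ε (≤-trans (inj₂ (sym (*-identityˡ rmax)))
        (*-mono-≤ (inj₁ 0<1) (inj₁ 0<rmax) (1≤fromℕ (1≤deg v)) ≤-refl))

      time′ : clock (push v σ₀) ℕ.≤ base ℕ.+ stepCost ℕ.* (T ℕ.+ (Y ℕ.+ deg v))
      time′ = ℕR.begin
        clock (push v σ₀)
          ℕR.≤⟨ P.time ⟩
        clock σ ℕ.+ c ℕ.+ pushCost ℕ.* d
          ℕR.≤⟨ ℕ.+-monoˡ-≤ (pushCost ℕ.* d) (ℕ.+-mono-≤ time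
                  (ℕ.m≤m*n c d {{ℕ.>-nonZero (1≤deg v)}})) ⟩
        base ℕ.+ stepCost ℕ.* (T ℕ.+ Y) ℕ.+ c ℕ.* d ℕ.+ pushCost ℕ.* d
          ℕR.≡⟨ ℕS.solve 6 (λ b T Y c p d →
                  b ℕS.:+ (c ℕS.:+ p) ℕS.:* (T ℕS.:+ Y) ℕS.:+ c ℕS.:* d ℕS.:+ p ℕS.:* d ℕS.:=
                  b ℕS.:+ (c ℕS.:+ p) ℕS.:* (T ℕS.:+ (Y ℕS.:+ d))) ≡.refl
                  base T Y c pushCost d ⟩
        base ℕ.+ stepCost ℕ.* (T ℕ.+ (Y ℕ.+ d)) ℕR.∎
        where
        c d : ℕ
        c = queueOp ℕ.+ queueOp
        d = deg v

    Halts : State → Set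
    Halts σ = ∃[ τ ] (σ ⇓ τ × ∃[ T ]
      (clock τ ℕ.≤ base ℕ.+ stepCost ℕ.* T ℕ.+ queueOp × ε * ε * fromℕ T ≤ B))

    -- Everything in the budget besides the pushed degree is nonnegative, so dropping it leaves ε² T
    -- ≤ B.
    halt : ∀ {σ φ} → queue σ ≡ [] → Between σ φ → Halts σ
    halt {σ} {φ} empty between = _ , stop empty , T , ℕ.+-monoˡ-≤ queueOp time ,
      ≤-trans (x≤x+y (*-nonneg (+-nonneg (*-nonneg (inj₁ 0<u)
        (Σ-nonneg φ (λ w → Balanced.credit-nonneg (balanced w))))
        (fromℕ-nonneg j)) 0≤m)) budget
      where open Between between

    mutual
      rounds : ∀ N {σ φ} → Between σ φ → Σ φ < fromℕ N * quantum → Halts σ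
      rounds N {σ} between fuel with queue σ in eq
      ... | []    = halt eq between
      ... | v ∷ q = step N (≡.subst (Round σ _) eq (beginRound between)) fuel

      step : ∀ N {σ φ v front} → Round σ φ (v ∷ front) → Σ φ < fromℕ N * quantum →
             Halts σ
      -- Without fuel the total credit would be negative.
      step zero {φ = φ} round fuel = ⊥-elim (≤⇒≯
        (Σ-nonneg φ (λ w → Balanced.credit-nonneg (Round.balanced round w)))
        (<-respʳ-≈ (zeroˡ quantum) fuel))
      step (suc N) {σ} {φ} {v} {front} round fuel =
        let ψ , round′ , decrease = advance round
            τ , run , bounds = continue N front round′ (fuel′ ψ decrease)
        in τ , loop (Round.queue≡ round) run , bounds
        where
        fuel′ : ∀ ψ → Σ ψ + quantum ≤ Σ φ → Σ ψ < fromℕ N * quantum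
        fuel′ ψ decrease with Σ ψ <? fromℕ N * quantum
        ... | yes Σψ<Nq = Σψ<Nq
        ... | no  Σψ≮Nq = ⊥-elim (≤⇒≯ (begin
          fromℕ (suc N) * quantum        ≈⟨ distribʳ quantum 1# _ ⟩
          1# * quantum + fromℕ N * quantum ≈⟨ +-congʳ (*-identityˡ _) ⟩
          quantum + fromℕ N * quantum    ≈⟨ +-comm _ _ ⟩
          fromℕ N * quantum + quantum    ≤⟨ +-mono-≤ (≮⇒≥ Σψ≮Nq) ≤-refl ⟩
          Σ ψ + quantum                  ≤⟨ decrease ⟩
          Σ φ                            ∎) fuel)

      continue : ∀ N {σ φ} front → Round σ φ front → Σ φ < fromℕ N * quantum → Halts σ
      continue N []          round fuel = rounds N (endRound round) fuel
      continue N (v ∷ front) round fuel = step N round fuel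

    fuel-for : ∀ x → ∃[ N ] x < fromℕ N * quantum
    fuel-for x = let N , x/q<N = archimedean (x / quantum) in N , (begin-strict
      x                         ≈⟨ *-identityʳ x ⟨
      x * 1#                    ≈⟨ *-congˡ (⁻¹-inverse quantum (pos⇒≉0 0<q)) ⟨
      x * (quantum * quantum ⁻¹) ≈⟨ solve 3 (λ x q i → x :* (q :* i) := q :* (x :* i))
                                     refl x quantum (quantum ⁻¹) ⟩
      quantum * (x / quantum)   <⟨ *-monoˡ-< quantum 0<q x/q<N ⟩
      quantum * fromℕ N         ≈⟨ *-comm _ _ ⟩
      fromℕ N * quantum         ∎)
      where
      0<q : 0# < quantum
      0<q = *-pos 0<ε (*-pos 0<ε 0<rmax)

    halts : ∀ {σ φ} → Between σ φ → Halts σ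
    halts {φ = φ} between = let N , fuel = fuel-for (Σ φ) in rounds N between fuel

  -- The initial state and the bound for a whole run

  degree≤m : ∀ w → fromℕ (deg w) ≤ m
  degree≤m w = begin
    degree w           ≈⟨ +-identityʳ _ ⟨
    degree w + 0#      ≤⟨ Σ[]≤Σ ([] ∷ []) degree (fromℕ-nonneg ∘ deg) ⟩
    Σ degree           ≈⟨ Σ-degree ⟩
    m                  ∎

  -- Absorbs the O(n) initialization into O(m). The comparison is made between reals, where
  -- `Σ-degree` applies, and then brought back to ℕ.
  n≤edges : n ℕ.≤ edges
  n≤edges = fromℕ-cancel-≤ (≤-trans
    (fromℕ≤Σ degree (λ w → 1≤fromℕ (1≤deg w))) (inj₂ Σ-degree))

  1≤edges : 1 ℕ.≤ edges
  1≤edges = fromℕ-cancel-≤ (≤-trans (fromℕ-mono-≤ (1≤deg s)) (degree≤m s))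

  -- Credit starts equal to residue. Only the queued source needs an argument: its credit 1 must
  -- reach ε θ(s), and θ(s) ≤ λ ≤ 1.
  initial-balanced : lam ≤ 1# → ∀ w → Balanced initial (residue initial) w
  initial-balanced lam≤1 w with w Fin.≟ s
  ... | yes ≡.refl = record
    { nonneg   = ≡.subst (0# ≤_) (≡.sym one) (inj₁ 0<1)
    ; residue≤ = ≤-refl
    ; queued   = λ _ → ≡.subst (ε * θ s ≤_) (≡.sym one) (begin
        ε * θ s   ≤⟨ εθ≤θ s ⟩
        θ s       ≤⟨ *-mono-≤ (fromℕ-nonneg (deg s)) (inj₁ 0<rmax) (degree≤m s) ≤-refl ⟩
        lam       ≤⟨ lam≤1 ⟩
        1#        ∎)
    ; settled  = λ s∉ → ⊥-elim (s∉ (here ≡.refl))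
    }
    where
    one : residue initial s ≡ 1#
    one = updateAt-updates s (const 0#)
  ... | no w≢s = record
    { nonneg   = ≡.subst (0# ≤_) (≡.sym nil) ≤-refl
    ; residue≤ = ≤-refl
    ; queued   = λ { (here w≡s) → ⊥-elim (w≢s w≡s) }
    ; settled  = λ _ → refl , ≡.subst (_≤ θ w) (≡.sym nil) (0≤θ w)
    }
    where
    nil : residue initial w ≡ 0#
    nil = updateAt-minimal w s (const 0#) w≢s

  Σ-initial : Σ (residue initial) ≈ 1#
  Σ-initial = begin-equality
    Σ (residue initial)                ≈⟨ +-identityʳ _ ⟨
    Σ (residue initial) + 0#           ≈⟨ Σ-updateAt (const 0#) s (const 1#) ⟩
    Σ {n} (const 0#) + 1#              ≈⟨ +-congʳ (Σ-const0 n) ⟩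
    0# + 1#                            ≈⟨ +-identityˡ 1# ⟩
    1#                                 ∎

  initial-time : clock initial ℕ.+ queueOp ℕ.≤ initialCost ℕ.* edges
  initial-time = ℕR.begin
    (n ℕ.+ n ℕ.+ 1) ℕ.* a ℕ.+ q ℕ.+ q
      ℕR.≡⟨ ℕS.solve 3 (λ n a q →
              (n ℕS.:+ n ℕS.:+ ℕS.con 1) ℕS.:* a ℕS.:+ q ℕS.:+ q ℕS.:=
              ℕS.con 2 ℕS.:* a ℕS.:* n ℕS.:+ (a ℕS.:+ ℕS.con 2 ℕS.:* q) ℕS.:* ℕS.con 1)
              ≡.refl n a q ⟩
    2 ℕ.* a ℕ.* n ℕ.+ (a ℕ.+ 2 ℕ.* q) ℕ.* 1
      ℕR.≤⟨ ℕ.+-mono-≤ (ℕ.*-monoʳ-≤ (2 ℕ.* a) n≤edges)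
                       (ℕ.*-monoʳ-≤ (a ℕ.+ 2 ℕ.* q) 1≤edges) ⟩
    2 ℕ.* a ℕ.* edges ℕ.+ (a ℕ.+ 2 ℕ.* q) ℕ.* edges
      ℕR.≡⟨ ℕS.solve 3 (λ m a q →
              ℕS.con 2 ℕS.:* a ℕS.:* m ℕS.:+ (a ℕS.:+ ℕS.con 2 ℕS.:* q) ℕS.:* m ℕS.:=
              (ℕS.con 3 ℕS.:* a ℕS.:+ ℕS.con 2 ℕS.:* q) ℕS.:* m) ≡.refl edges a q ⟩
    initialCost ℕ.* edges ℕR.∎
    where
    a q : ℕ
    a = assignment
    q = queueOp

  -- The right-hand side is the initial value of the budget: one unit for total credit 1 at u = 1
  -- and one for each of the J phases, all times m.
  run-bound : ∀ J → lam ≤ 1# → 1# ≤ fromℕ (2 ℕ.^ J) * lam →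
    ∃[ τ ] (initial ⇓ τ × ∃[ T ]
      (clock τ ℕ.≤ initialCost ℕ.* edges ℕ.+ stepCost ℕ.* T ×
       ε * ε * fromℕ T ≤ fromℕ (suc J) * m))
  run-bound J lam≤1 scale =
    let τ , run , T , time , budget = halts between
    in τ , run , T , ℕ.≤-trans time (total T) , budget
    where
    open Execution (clock initial) (fromℕ (suc J) * m)

    between : Between initial (residue initial)
    between = record
      { balanced = initial-balanced lam≤1
      ; unique   = [] ∷ []
      ; T        = 0
      ; u        = 1#
      ; j        = J
      ; 0<u      = 0<1
      ; scale    = ≤-trans scale (inj₂ (*-congʳ (sym (*-identityˡ _))))
      ; budget   = inj₂ (begin-equality
          ε * ε * 0# + (1# * Σ (residue initial) + fromℕ J) * m
            ≈⟨ +-cong (zeroʳ _) (*-congʳ (+-congʳ (trans (*-identityˡ _) Σ-initial))) ⟩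
          0# + fromℕ (suc J) * m
            ≈⟨ +-identityˡ _ ⟩
          fromℕ (suc J) * m ∎)
      ; time     = ℕ.m≤m+n _ _
      }

    total : ∀ T → clock initial ℕ.+ stepCost ℕ.* T ℕ.+ queueOp ℕ.≤
                  initialCost ℕ.* edges ℕ.+ stepCost ℕ.* T
    total T = ℕR.begin
      clock initial ℕ.+ stepCost ℕ.* T ℕ.+ queueOp
        ℕR.≡⟨ ℕS.solve 3 (λ a b c → a ℕS.:+ b ℕS.:+ c ℕS.:= a ℕS.:+ c ℕS.:+ b) ≡.refl
                (clock initial) (stepCost ℕ.* T) queueOp ⟩
      clock initial ℕ.+ queueOp ℕ.+ stepCost ℕ.* T
        ℕR.≤⟨ ℕ.+-monoˡ-≤ (stepCost ℕ.* T) initial-time ⟩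
      initialCost ℕ.* edges ℕ.+ stepCost ℕ.* T ℕR.∎

-- Powers of two and the binary logarithm

module LogBounds (ℛ : CompleteOrderedField) where
  open CompleteOrderedField ℛ hiding (zero)
  open RealProperties ℛ
  open OrderedField ℛ
  open Logarithm ℛ
  open import Relation.Binary.Reasoning.StrictPartialOrder strictPartialOrder

  -- k only starts a downward search; 2 ≤ y makes the lower exponent found positive.
  between-powers : ∀ k {y} → fromℕ 2 ≤ y → y < fromℕ (2 ℕ.^ k) →
    ∃[ j ] (fromℕ (2 ℕ.^ suc j) ≤ y × y < fromℕ (2 ℕ.^ suc (suc j)))
  between-powers zero 2≤y y<1 =
    ⊥-elim (≤⇒≯ 2≤y (<-trans y<1 (fromℕ-mono-< {1} {2} (s≤s (s≤s z≤n)))))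
  between-powers (suc k) {y} 2≤y y<2^1+k with y <? fromℕ (2 ℕ.^ k)
  ... | yes y<2^k = between-powers k 2≤y y<2^k
  between-powers (suc zero)    2≤y y<2 | no _ = ⊥-elim (≤⇒≯ 2≤y y<2)
  between-powers (suc (suc j)) _ y<2^2+j | no y≮ = j , ≮⇒≥ y≮ , y<2^2+j

  log₂-≥ : ∀ {y} k → 0# < y → fromℕ (2 ℕ.^ k) ≤ y → fromℕ k ≤ log₂ y
  log₂-≥ {y} k 0<y 2^k≤y = proj₁ (log₂-supremum 0<y) (fromℕ k)
    -- The integer k is presented as the rational (k - 0) / (0 + 1).
    (k , 0 , 0 ,
     trans (+-identityʳ _) (trans (*-congʳ fromℕ-1) (*-identityˡ _)) ,
     ≤-trans 2^k≤y (inj₂ (sym (trans (*-congʳ fromℕ-1)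
       (trans (*-identityˡ _) (*-identityʳ y))))))

  module _ {x : Carrier} (0<x : 0# < x) (2x<1 : fromℕ 2 * x < 1#) where

    x*1/x : x * (1# / x) ≈ 1#
    x*1/x = trans (*-congˡ (*-identityˡ (x ⁻¹))) (⁻¹-inverse x (pos⇒≉0 0<x))

    2≤1/x : fromℕ 2 ≤ 1# / x
    2≤1/x = ≮⇒≥ λ 1/x<2 → <-irrefl refl (begin-strict
      1#          ≈⟨ x*1/x ⟨
      x * (1# / x) <⟨ *-monoˡ-< x 0<x 1/x<2 ⟩
      x * fromℕ 2 ≈⟨ *-comm _ _ ⟩
      fromℕ 2 * x <⟨ 2x<1 ⟩
      1#          ∎)

    -- Consecutive powers of two enclose 1 / x: the upper exponent j + 2 is the number J of phases,
    -- the lower one bounds the logarithm from below. As x < 1/2, the lower exponent is at least 1,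
    -- so J + 1 is at most three times the logarithm.
    phases : ∃[ j ] (1# ≤ fromℕ (2 ℕ.^ suc (suc j)) * x ×
                     fromℕ (suc j) ≤ log₂ (1# / x))
    phases =
      let k , 1/x<2^k = <2^ (1# / x)
          j , 2^1+j≤1/x , 1/x<2^2+j = between-powers k 2≤1/x 1/x<2^k
      in j ,
         inj₁ (<-respˡ-≈ x*1/x (<-respʳ-≈ (*-comm _ _) (*-monoˡ-< x 0<x 1/x<2^2+j))) ,
         log₂-≥ (suc j) (<-≤-trans (fromℕ-suc-pos 1) 2≤1/x) 2^1+j≤1/x

-- From the budget in powers of two to m log (1 / λ)

theorem4p3 :
    (ℛ : CompleteOrderedField) (κ : Costs) →
    let open CompleteOrderedField ℛ
        open Logarithm ℛ
    in
    (α : Carrier) → 0# < α → α < 1# →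
    ∃[ C ] (∀ (n : ℕ) (G : Digraph n) →
      let open Digraph G in
      (∀ v → 1 ℕ.≤ deg v) →
      (s : Fin n) (rmax : Carrier) →
      0# < rmax → rmax < 1# / fromℕ (2 ℕ.* edges) →
      let m = fromℕ edges
          lam = m * rmax
          open FIFO-FwdPush ℛ κ G α s rmax
      in
      ∃[ τ ] (initial ⇓ τ × fromℕ (clock τ) ≤ C * (m * log₂ (1# / lam))))
theorem4p3 ℛ κ α 0<α α<1 = C , bound
  where
  open CompleteOrderedField ℛ hiding (zero)
  open RealProperties ℛ
  open OrderedField ℛ
  open Logarithm ℛ
  open LogBounds ℛ
  open Parameters ℛ α 0<α α<1
  open CostConstants κ
  open import Relation.Binary.Reasoning.StrictPartialOrder strictPartialOrder

  η : Carrier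
  η = (ε * ε) ⁻¹

  0<ε² : 0# < ε * ε
  0<ε² = *-pos 0<ε 0<ε

  -- The factor of `stepCost` is 3 / ε², that is 27 / α²: ε² is the weight of pushed degree in the
  -- budget, and 3 comes from `3+j≤3L`.
  C : Carrier
  C = fromℕ (initialCost) + fromℕ (stepCost) * (η * fromℕ 3)

  bound : ∀ (n : ℕ) (G : Digraph n) →
      let open Digraph G in
      (∀ v → 1 ℕ.≤ deg v) →
      (s : Fin n) (rmax : Carrier) →
      0# < rmax → rmax < 1# / fromℕ (2 ℕ.* edges) →
      let m = fromℕ edges
          lam = m * rmax
          open FIFO-FwdPush ℛ κ G α s rmax
      in
      ∃[ τ ] (initial ⇓ τ × fromℕ (clock τ) ≤ C * (m * log₂ (1# / lam)))
  bound n G 1≤deg s rmax 0<rmax rmax<1/2m =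
    let τ , run , T , time , budget = run-bound (suc (suc j)) lam≤1 1≤2^2+j*lam
    in τ , run , clock-bound (clock τ) T time budget
    where
    open Digraph G using (edges)
    open FIFO-FwdPush ℛ κ G α s rmax using (clock)
    open PushAnalysis ℛ κ G α 0<α α<1 1≤deg s rmax 0<rmax

    0<m : 0# < m
    0<m = <-≤-trans 0<1 (1≤fromℕ 1≤edges)

    0<lam : 0# < lam
    0<lam = *-pos 0<m 0<rmax

    2lam<1 : fromℕ 2 * lam < 1#
    2lam<1 = begin-strict
      fromℕ 2 * (m * rmax)    ≈⟨ *-assoc _ _ _ ⟨
      fromℕ 2 * m * rmax      ≈⟨ *-congʳ (×1-homo-* 2 edges) ⟨
      2m * rmax               <⟨ *-monoˡ-< 2m 0<2m rmax<1/2m ⟩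
      2m * (1# / 2m)          ≈⟨ *-congˡ (*-identityˡ _) ⟩
      2m * 2m ⁻¹              ≈⟨ ⁻¹-inverse 2m (pos⇒≉0 0<2m) ⟩
      1#                      ∎
      where
      2m : Carrier
      2m = fromℕ (2 ℕ.* edges)

      0<2m : 0# < 2m
      0<2m = <-≤-trans 0<m (fromℕ-mono-≤ (ℕ.m≤m+n edges _))

    lam≤1 : lam ≤ 1#
    lam≤1 = begin
      lam          ≈⟨ *-identityˡ lam ⟨
      1# * lam     ≤⟨ *-mono-≤ (inj₁ 0<1) (inj₁ 0<lam) (1≤fromℕ {2} (s≤s z≤n)) ≤-refl ⟩
      fromℕ 2 * lam ≤⟨ inj₁ 2lam<1 ⟩
      1#           ∎

    L : Carrier
    L = log₂ (1# / lam)

    j : ℕ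
    j = proj₁ (phases 0<lam 2lam<1)

    1≤2^2+j*lam : 1# ≤ fromℕ (2 ℕ.^ suc (suc j)) * lam
    1≤2^2+j*lam = proj₁ (proj₂ (phases 0<lam 2lam<1))

    1+j≤L : fromℕ (suc j) ≤ L
    1+j≤L = proj₂ (proj₂ (phases 0<lam 2lam<1))

    -- Since L ≥ 1, the initialization cost, linear in m, fits under a multiple of m L.
    m≤mL : m ≤ m * L
    m≤mL = begin
      m      ≈⟨ *-identityʳ m ⟨
      m * 1# ≤⟨ *-monoʳ-≤ 0≤m (≤-trans (1≤fromℕ {suc j} (s≤s z≤n)) 1+j≤L) ⟩
      m * L  ∎

    -- The left side is J + 1, the number of units in the initial budget, for J = j + 2.
    3+j≤3L : fromℕ (suc (suc (suc j))) ≤ fromℕ 3 * L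
    3+j≤3L = begin
      fromℕ (3 ℕ.+ j)         ≤⟨ fromℕ-mono-≤ (ℕ.≤-trans
                                   (ℕ.+-monoʳ-≤ 3 (ℕ.m≤n*m j 3))
                                   (ℕ.≤-reflexive (≡.sym (ℕ.*-distribˡ-+ 3 1 j)))) ⟩
      fromℕ (3 ℕ.* suc j)     ≈⟨ ×1-homo-* 3 (suc j) ⟩
      fromℕ 3 * fromℕ (suc j) ≤⟨ *-monoʳ-≤ (fromℕ-nonneg 3) 1+j≤L ⟩
      fromℕ 3 * L             ∎

    clock-bound : ∀ t T → t ℕ.≤ initialCost ℕ.* edges ℕ.+ stepCost ℕ.* T →
                  ε * ε * fromℕ T ≤ fromℕ (suc (suc (suc j))) * m →
                  fromℕ t ≤ C * (m * L)
    clock-bound t T time budget = begin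
      fromℕ t
        ≤⟨ fromℕ-mono-≤ time ⟩
      fromℕ (initialCost ℕ.* edges ℕ.+ stepCost ℕ.* T)
        ≈⟨ trans (fromℕ-+ (initialCost ℕ.* edges) _)
             (+-cong (×1-homo-* (initialCost) edges) (×1-homo-* (stepCost) T)) ⟩
      I * m + S * fromℕ T
        ≤⟨ +-mono-≤ (*-monoʳ-≤ (fromℕ-nonneg (initialCost)) m≤mL)
                    (*-monoʳ-≤ (fromℕ-nonneg (stepCost)) T≤) ⟩
      I * (m * L) + S * (η * (fromℕ 3 * L * m))
        ≈⟨ solve 6 (λ i m l s h t → i :* (m :* l) :+ s :* (h :* (t :* l :* m)) :=
             (i :+ s :* (h :* t)) :* (m :* l)) refl I m L S η (fromℕ 3) ⟩
      C * (m * L) ∎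
      where
      I S : Carrier
      I = fromℕ (initialCost)
      S = fromℕ (stepCost)

      T≤ : fromℕ T ≤ η * (fromℕ 3 * L * m)
      T≤ = begin
        fromℕ T                  ≈⟨ *-identityˡ _ ⟨
        1# * fromℕ T             ≈⟨ *-congʳ (trans (*-comm _ _)
                                      (⁻¹-inverse (ε * ε) (pos⇒≉0 0<ε²))) ⟨
        η * (ε * ε) * fromℕ T    ≈⟨ *-assoc _ _ _ ⟩
        η * (ε * ε * fromℕ T)    ≤⟨ *-monoʳ-≤ (inj₁ (⁻¹-pos 0<ε²)) (≤-trans budget
                                      (*-mono-≤ (fromℕ-nonneg (suc (suc (suc j)))) 0≤m
                                        3+j≤3L ≤-refl)) ⟩
        η * (fromℕ 3 * L * m)    ∎
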